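{- For an arbitrary snark $G$, the following statements are equivalent: (i) $G$ is bicritical; (ii) $G$ is $4$-vertex-critical; (iii) $G$ is $7$-irreducible; (iv) $G$ is irreducible.
   Context: Graphs may have parallel edges and loops. A snark is a connected cubic graph that admits no proper edge-colouring with three colours (equivalently, no nowhere-zero $4$-flow). For distinct vertices $u,v$ of $G$, $G-\{u,v\}$ denotes the graph obtained by removing $u$ and $v$ but retaining the edges formerly incident with them as dangling edges, and $G/\{u,v\}$ denotes the graph obtained by identifying $u$ and $v$. A snark $G$ is bicritical if $G-\{u,v\}$ is $3$-edge-colourable for every pair of distinct vertices $u,v$. A snark $G$ is $4$-vertex-critical if $G/\{u,v\}$ admits a nowhere-zero $4$-flow for every pair of distinct vertices $u,v$. For an integer $k\ge1$, a snark $G$ is $k$-irreducible if removing fewer than $k$ edges from $G$ never produces a component of chromatic index $4$ that can be completed (by adding vertices and edges) to a cubic graph $H$ with fewer vertices than $G$; $G$ is irreducible if it is $k$-irreducible for every $k\ge1$. -}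

module Defs where

open import Data.Nat using (ℕ; zero; suc; _+_; _<_; _≤_)
open import Data.Fin using (Fin; zero; suc; punchOut)
open import Data.Fin.Properties using () renaming (_≟_ to _≟ᶠ_)
open import Data.Maybe using (Maybe; just; nothing; map)
open import Data.Maybe.Properties using (≡-dec)
open import Data.Bool using (Bool; true; false; if_then_else_)
open import Data.Integer as ℤ using (ℤ; ∣_∣)
open import Data.Product using (Σ; Σ-syntax; _×_; _,_)
open import Data.Sum using (_⊎_)
open import Relation.Nullary using (¬_; Dec; yes; no)
open import Relation.Nullary.Decidable using (⌊_⌋)
open import Relation.Binary.PropositionalEquality using (_≡_; _≢_; sym)
open import Relation.Binary.Construct.Closure.ReflexiveTransitive using (Star)

-- Graphs with parallel edges, loops and dangling edges (multipoles).
-- Vertices are Fin nV, edges are Fin nE; every edge has two ends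
-- (Fin 2), each end is either attached to a vertex (just v) or free
-- (nothing).  A loop has both ends at the same vertex; a dangling
-- edge has one free end; an isolated edge has two free ends.
-- A "graph" in the ordinary sense is one with no free ends (IsGraph).

record Graph : Set where
  constructor mkGraph
  field
    nV  : ℕ
    nE  : ℕ
    end : Fin nE → Fin 2 → Maybe (Fin nV)
open Graph public

sumℕ : ∀ {m} → (Fin m → ℕ) → ℕ
sumℕ {zero}  f = 0
sumℕ {suc m} f = f zero + sumℕ (λ i → f (suc i))

sumℤ : ∀ {m} → (Fin m → ℤ) → ℤ
sumℤ {zero}  f = ℤ.0ℤ
sumℤ {suc m} f = f zero ℤ.+ sumℤ (λ i → f (suc i))

_≟ᵐ_ : ∀ {n} (x y : Maybe (Fin n)) → Dec (x ≡ y)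
_≟ᵐ_ = ≡-dec _≟ᶠ_

swap2 : Fin 2 → Fin 2
swap2 zero = suc zero
swap2 (suc _) = zero

IsGraph : Graph → Set
IsGraph G = ∀ e i → Σ[ v ∈ Fin (nV G) ] end G e i ≡ just v

-- degree: number of edge-ends at v (a loop counts twice)
deg : (G : Graph) → Fin (nV G) → ℕ
deg G v = sumℕ λ e → sumℕ λ i → if ⌊ end G e i ≟ᵐ just v ⌋ then 1 else 0

Cubic : Graph → Set
Cubic G = IsGraph G × (∀ v → deg G v ≡ 3)

Adj : (G : Graph) → Fin (nV G) → Fin (nV G) → Set
Adj G u v = Σ[ e ∈ Fin (nE G) ]
  ((end G e zero ≡ just u × end G e (suc zero) ≡ just v)
   ⊎ (end G e zero ≡ just v × end G e (suc zero) ≡ just u))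

Connected : Graph → Set
Connected G = ∀ u v → Star (Adj G) u v

-- proper 3-edge-colouring: distinct edge-ends meeting at a vertex get
-- distinct colours (so a loop prevents colourability); free ends impose
-- no constraint.
Colourable : Graph → Set
Colourable G = Σ[ c ∈ (Fin (nE G) → Fin 3) ]
  (∀ v e i e′ i′ → (e , i) ≢ (e′ , i′) →
     end G e i ≡ just v → end G e′ i′ ≡ just v → c e ≢ c e′)

Snark : Graph → Set
Snark G = Cubic G × Connected G × ¬ Colourable G

-- G - {u,v}: delete the vertices, keep incident edges as dangling edges.

delEnd : ∀ {k} → Fin (suc k) → Maybe (Fin (suc k)) → Maybe (Fin k)
delEnd u nothing = nothing
delEnd u (just w) with w ≟ᶠ u
... | yes _ = nothing
... | no w≢u = just (punchOut {i = u} {j = w} (λ eq → w≢u (sym eq)))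

delete1 : (G : Graph) → Fin (nV G) → Graph
delete1 (mkGraph zero m end) ()
delete1 (mkGraph (suc k) m end) u = mkGraph k m (λ e i → delEnd u (end e i))

remove2 : (G : Graph) (u v : Fin (nV G)) → u ≢ v → Graph
remove2 (mkGraph zero m end) () v ne
remove2 (mkGraph (suc k) m end) u v ne =
  delete1 (mkGraph k m (λ e i → delEnd u (end e i))) (punchOut {i = u} {j = v} ne)

mergeV : ∀ {k} (u v : Fin (suc k)) → u ≢ v → Fin (suc k) → Fin k
mergeV u v ne w with w ≟ᶠ v
... | yes _   = punchOut {i = v} {j = u} (λ eq → ne (sym eq))
... | no w≢v = punchOut {i = v} {j = w} (λ eq → w≢v (sym eq))

identify : (G : Graph) (u v : Fin (nV G)) → u ≢ v → Graph
identify (mkGraph zero m end) () v ne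
identify (mkGraph (suc k) m end) u v ne =
  mkGraph k m (λ e i → map (mergeV u v ne) (end e i))

-- Nowhere-zero 4-flow: an orientation o (o e = true reverses the
-- edge) and integer values with 1 ≤ |f e| ≤ 3, with Kirchhoff's law at
-- every vertex (inflow = outflow).

headE : (G : Graph) → (Fin (nE G) → Bool) → Fin (nE G) → Maybe (Fin (nV G))
headE G o e = if o e then end G e zero else end G e (suc zero)

tailE : (G : Graph) → (Fin (nE G) → Bool) → Fin (nE G) → Maybe (Fin (nV G))
tailE G o e = if o e then end G e (suc zero) else end G e zero

HasNZ4Flow : Graph → Set
HasNZ4Flow G = Σ[ o ∈ (Fin (nE G) → Bool) ] Σ[ f ∈ (Fin (nE G) → ℤ) ]
  ((∀ e → 1 ≤ ∣ f e ∣ × ∣ f e ∣ ≤ 3) ×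
   (∀ v → sumℤ (λ e → (if ⌊ headE G o e ≟ᵐ just v ⌋ then f e else ℤ.0ℤ)
                   ℤ.- (if ⌊ tailE G o e ≟ᵐ just v ⌋ then f e else ℤ.0ℤ))
          ≡ ℤ.0ℤ))

Bicritical : Graph → Set
Bicritical G = ∀ u v → (ne : u ≢ v) → Colourable (remove2 G u v ne)

FourVertexCritical : Graph → Set
FourVertexCritical G = ∀ u v → (ne : u ≢ v) → HasNZ4Flow (identify G u v ne)

-- Irreducibility.  F ⊆ E(G) is the set of removed edges; each removed
-- edge is split into two dangling edges, one at each former end.  A
-- component of the result is given by its vertex set S ⊆ V(G).

count : ∀ {m} → (Fin m → Bool) → ℕ
count F = sumℕ (λ e → if F e then 1 else 0)

module _ (G : Graph) (F : Fin (nE G) → Bool) (S : Fin (nV G) → Bool) where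

  AdjOff : Fin (nV G) → Fin (nV G) → Set
  AdjOff u v = Σ[ e ∈ Fin (nE G) ] F e ≡ false ×
    ((end G e zero ≡ just u × end G e (suc zero) ≡ just v)
     ⊎ (end G e zero ≡ just v × end G e (suc zero) ≡ just u))

  Component : Set
  Component =
    (Σ[ v ∈ Fin (nV G) ] S v ≡ true) ×
    (∀ e u v → F e ≡ false → end G e zero ≡ just u →
       end G e (suc zero) ≡ just v → S u ≡ S v) ×
    (∀ u v → S u ≡ true → S v ≡ true → Star AdjOff u v)

  -- the component (with the dangling halves of removed edges) is
  -- 3-edge-colourable: colours are given per edge-end; the two ends of
  -- a non-removed edge carry the same colour, the two halves of a
  -- removed edge are independent; properness at vertices of S.
  ComponentColourable : Set
  ComponentColourable = Σ[ c ∈ (Fin (nE G) → Fin 2 → Fin 3) ]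
    ((∀ e → F e ≡ false → c e zero ≡ c e (suc zero)) ×
     (∀ v → S v ≡ true → ∀ e i e′ i′ → (e , i) ≢ (e′ , i′) →
        end G e i ≡ just v → end G e′ i′ ≡ just v → c e i ≢ c e′ i′))

  Internal : Fin (nE G) → Set
  Internal e = F e ≡ false ×
    (∀ i → Σ[ v ∈ Fin (nV G) ] end G e i ≡ just v × S v ≡ true)

  -- the component can be completed, by adding vertices and edges, to a
  -- cubic graph H with fewer vertices than G: its vertices and internal
  -- edges embed injectively into H preserving incidences (the dangling
  -- edges are then completed by the remaining edge-ends of H).
  CompletableToSmaller : Set
  CompletableToSmaller = Σ[ H ∈ Graph ] Cubic H × nV H < nV G ×
    Σ[ φ ∈ (Fin (nV G) → Fin (nV H)) ] Σ[ ψ ∈ (Fin (nE G) → Fin (nE H)) ]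
      ((∀ u v → S u ≡ true → S v ≡ true → φ u ≡ φ v → u ≡ v) ×
       (∀ e e′ → Internal e → Internal e′ → ψ e ≡ ψ e′ → e ≡ e′) ×
       (∀ e → Internal e →
          (∀ i → end H (ψ e) i ≡ map φ (end G e i))
          ⊎ (∀ i → end H (ψ e) i ≡ map φ (end G e (swap2 i)))))

KIrreducible : ℕ → Graph → Set
KIrreducible k G = ∀ (F : Fin (nE G) → Bool) → count F < k →
  ∀ (S : Fin (nV G) → Bool) → Component G F S →
  ¬ ComponentColourable G F S → ¬ CompletableToSmaller G F S

Irreducible : Graph → Set
Irreducible G = ∀ k → 1 ≤ k → KIrreducible k G

{-# OPTIONS --safe #-}

-- A nowhere-zero 4-flow is the same as a nowhere-zero ℤ₂ × ℤ₂-flow: a cycle mod 2 lifts to an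
-- integer cycle with values in {-1, 0, 1}, so two lifts x, y of cycles mod 2 covering all edges
-- give the flow x + 2y, and conversely an integer flow x reduces to the pair (x, (x + y) / 2),
-- where y lifts x mod 2.  The three nonzero elements of ℤ₂ × ℤ₂ are the colours, and three colours
-- are distinct exactly when they add up to zero, which is Kirchhoff's law at a vertex of degree 3.
-- Hence a colouring of G − {u, v} is a flow on G / {u, v}; the law at the merged vertex follows
-- from the others.
--
-- If a component embeds into a smaller cubic graph, then by parity at least two vertices lie
-- outside it, and a colouring of G without these two restricts to the component.  Conversely, if
-- G − {u, v} is uncolourable, then so is one of its components; it is cut off by the at most six
-- edges at u and v, and joining the dangling edges of G − {u, v} in pairs embeds it into a cubic
-- graph with two vertices fewer than G.

module Submission where

open import Defs
open import Algebra.Bundles using (CommutativeMonoid; Monoid; Ring; Semiring)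
open import Algebra.Morphism.Structures using (module MonoidMorphisms; module RingMorphisms)
import Algebra.Properties.CommutativeMonoid.Sum as CommutativeMonoidSum
import Algebra.Properties.Monoid.Sum as MonoidSum
import Algebra.Properties.Ring as RingProperties
import Algebra.Properties.Semiring.Sum as SemiringSum
open import Data.Bool using (Bool; true; false; if_then_else_; not)
open import Data.Bool.Properties using (¬-not; not-injective) renaming (_≟_ to _≟ᵇ_)
open import Data.Fin
  using (Fin; zero; suc; punchIn; punchOut; splitAt; _↑ˡ_; finToFun; funToFin)
open import Data.Fin.Patterns using (0F; 1F; 2F)
open import Data.Fin.Properties
  using (any?; all?; punchIn-injective; punchInᵢ≢i; punchIn-punchOut; punchOut-cong;
    punchOut-injective; punchOut-punchIn; injective⇒≤; ↑ˡ-injective; finToFun-funToFin; sequence)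
  renaming (_≟_ to _≟ᶠ_)
open import Data.Integer as ℤ using (ℤ; ∣_∣; 0ℤ; 1ℤ; -1ℤ; -[1+_]; _⊖_)
import Data.Integer.Properties as ℤₚ
open import Data.Integer.Tactic.RingSolver using (solve-∀)
open import Data.List as List
  using (List; []; _∷_; _++_; length; lookup; tabulate; allFin; filter; mapMaybe; cartesianProduct)
open import Data.List.Membership.Propositional using (_∈_)
open import Data.List.Membership.Propositional.Properties
  using (∈-allFin; ∈-lookup; ∈-cartesianProduct⁺; ∈-filter⁺; ∈-filter⁻)
open import Data.List.Membership.Setoid.Properties using (index-injective)
open import Data.List.Properties using (length-map; filter-≐; mapMaybe-cong; mapMaybe-nothing)
import Data.List.Relation.Unary.All as All
open import Data.List.Relation.Unary.AllPairs using (AllPairs; allPairs?; []; _∷_)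
import Data.List.Relation.Unary.AllPairs.Properties as AllPairs
open import Data.List.Relation.Unary.Any as Any using (here; there)
import Data.List.Relation.Unary.Any.Properties as Any
open import Data.List.Relation.Unary.Unique.Propositional using (Unique)
import Data.List.Relation.Unary.Unique.Propositional.Properties as Unique
open import Data.Maybe using (Maybe; just; nothing; map; maybe′; fromMaybe)
open import Data.Maybe.Properties using (just-injective)
open import Data.Nat as ℕ using (ℕ; zero; suc; parity; _≤_; _<_; z≤n; s≤s)
import Data.Nat.Properties as ℕₚ
open import Data.Parity as ℙ using (Parity; 0ℙ; 1ℙ; _⁻¹)
import Data.Parity.Properties as ℙₚ
open import Data.Product using (Σ; Σ-syntax; ∃; _×_; _,_; proj₁; proj₂; map₂)
open import Data.Product.Properties using () renaming (≡-dec to ×-≡-dec)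
open import Data.Sum as Sum using (_⊎_; inj₁; inj₂; [_,_]′)
open import Data.Unit using (⊤; tt)
open import Data.Vec.Functional as Vector using (Vector; removeAt; insertAt; replicate)
open import Data.Vec.Functional.Properties using (insertAt-lookup; insertAt-punchIn; lookup-++ˡ)
open import Effect.Monad using (RawMonad)
open import Function using (_∘_; const; id)
open import Function.Bundles using (_⇔_; mk⇔; Equivalence)
open import Function.Properties.Equivalence using () renaming (sym to ⇔-sym; trans to ⇔-trans)
open import Level using (Level)
open import Relation.Binary using (DecidableEquality; Symmetric)
open import Relation.Binary.Construct.Closure.Equivalence as EqClosure using (EqClosure)
open import Relation.Binary.Construct.Closure.ReflexiveTransitive as Star using (Star; _◅◅_)
open import Relation.Binary.Construct.Closure.Symmetric as SymClosure using (fwd)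
open import Relation.Binary.PropositionalEquality
  using (_≡_; _≢_; refl; sym; trans; cong; cong₂; cong-app; subst; module ≡-Reasoning)
  renaming (setoid to ≡-setoid; isEquivalence to ≡-isEquivalence)
import Relation.Binary.Reasoning.Setoid as ≈-Reasoning
open import Relation.Nullary
  using (¬_; Dec; yes; no; contradiction; ¬¬-map; ¬?; _×-dec_; _⊎-dec_; _→-dec_)
open import Relation.Nullary.Decidable
  using (⌊_⌋; does; dec-true; decidable-stable; from-yes; map′)
open import Relation.Nullary.Negation using (¬¬-Monad)
open import Relation.Unary using (Pred; Decidable)

private variable
  m n : ℕ
  ℓᵃ ℓᵇ : Level
  A : Set ℓᵃ
  B : Set ℓᵇ

-- Finite sums

module _ {c ℓ} (M : CommutativeMonoid c ℓ) where
  open CommutativeMonoid M using (Carrier; _≈_; _∙_; ε; setoid; ∙-congˡ; identityʳ)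
  open CommutativeMonoidSum M

  sum-supported-at : (f : Vector Carrier n) (i : Fin n) → (∀ j → j ≢ i → f j ≈ ε) → sum f ≈ f i
  sum-supported-at {suc n} f i vanishes = begin
    sum f                          ≈⟨ sum-remove f ⟩
    f i ∙ sum (removeAt f i)       ≈⟨ ∙-congˡ (sum-cong-≋ elsewhere) ⟩
    f i ∙ sum (replicate n ε)      ≈⟨ ∙-congˡ (sum-replicate-zero n) ⟩
    f i ∙ ε                        ≈⟨ identityʳ (f i) ⟩
    f i                            ∎
    where
    open ≈-Reasoning setoid
    elsewhere : ∀ j → f (punchIn i j) ≈ ε
    elsewhere j = vanishes (punchIn i j) (punchInᵢ≢i i j)

module _ {a b ℓ₁ ℓ₂} (M : Monoid a ℓ₁) (N : Monoid b ℓ₂) where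
  private
    module M = Monoid M
    module N = Monoid N
  open MonoidMorphisms M.rawMonoid N.rawMonoid using (IsMonoidHomomorphism)

  sum-homo : {h : M.Carrier → N.Carrier} → IsMonoidHomomorphism h → (f : Vector M.Carrier n) →
    h (MonoidSum.sum M f) N.≈ MonoidSum.sum N (h ∘ f)
  sum-homo {zero}  h-homo f = ε-homo where open IsMonoidHomomorphism h-homo
  sum-homo {suc n} h-homo f = N.trans (homo (f zero) _) (N.∙-congˡ (sum-homo h-homo (f ∘ suc)))
    where open IsMonoidHomomorphism h-homo

module Summation {c ℓ} (M : Monoid c ℓ) where
  open Monoid M renaming (refl to ≈-refl; sym to ≈-sym; trans to ≈-trans)
  open MonoidSum M

  ∑ˡ : (A → Carrier) → List A → Carrier
  ∑ˡ f = List.foldr (λ x s → f x ∙ s) ε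

  ∑ˡ-++ : (f : A → Carrier) (xs ys : List A) → ∑ˡ f (xs ++ ys) ≈ ∑ˡ f xs ∙ ∑ˡ f ys
  ∑ˡ-++ f []       ys = ≈-sym (identityˡ _)
  ∑ˡ-++ f (x ∷ xs) ys = ≈-trans (∙-congˡ (∑ˡ-++ f xs ys)) (≈-sym (assoc (f x) _ _))

  ∑ˡ-map : (f : B → Carrier) (g : A → B) (xs : List A) → ∑ˡ f (List.map g xs) ≈ ∑ˡ (f ∘ g) xs
  ∑ˡ-map f g []       = ≈-refl
  ∑ˡ-map f g (x ∷ xs) = ∙-congˡ (∑ˡ-map f g xs)

  ∑ˡ-filter : ∀ {p} {P : Pred A p} (P? : Decidable P) (f : A → Carrier) (xs : List A) →
    ∑ˡ f (filter P? xs) ≈ ∑ˡ (λ x → if ⌊ P? x ⌋ then f x else ε) xs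
  ∑ˡ-filter P? f []       = ≈-refl
  ∑ˡ-filter P? f (x ∷ xs) with P? x
  ... | yes _ = ∙-congˡ (∑ˡ-filter P? f xs)
  ... | no _  = ≈-trans (∑ˡ-filter P? f xs) (≈-sym (identityˡ _))

  ∑ˡ-mapMaybe : (f : B → Carrier) (g : A → Maybe B) (xs : List A) →
    ∑ˡ f (mapMaybe g xs) ≈ ∑ˡ (maybe′ f ε ∘ g) xs
  ∑ˡ-mapMaybe f g []       = ≈-refl
  ∑ˡ-mapMaybe f g (x ∷ xs) with g x
  ... | just _  = ∙-congˡ (∑ˡ-mapMaybe f g xs)
  ... | nothing = ≈-trans (∑ˡ-mapMaybe f g xs) (≈-sym (identityˡ _))

  ∑ˡ-cartesianProduct : (f : A × B → Carrier) (xs : List A) (ys : List B) →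
    ∑ˡ f (cartesianProduct xs ys) ≈ ∑ˡ (λ x → ∑ˡ (λ y → f (x , y)) ys) xs
  ∑ˡ-cartesianProduct f []       ys = ≈-refl
  ∑ˡ-cartesianProduct f (x ∷ xs) ys = ≈-trans (∑ˡ-++ f (List.map (x ,_) ys) _)
    (∙-cong (∑ˡ-map f (x ,_) ys) (∑ˡ-cartesianProduct f xs ys))

  ∑ˡ-tabulate : (f : A → Carrier) (g : Vector A n) → ∑ˡ f (tabulate g) ≡ sum (f ∘ g)
  ∑ˡ-tabulate {n = zero}  f g = refl
  ∑ˡ-tabulate {n = suc n} f g = cong (f (g zero) ∙_) (∑ˡ-tabulate f (g ∘ suc))

  sum-lookup : (f : A → Carrier) (xs : List A) → sum (f ∘ lookup xs) ≡ ∑ˡ f xs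
  sum-lookup f []       = refl
  sum-lookup f (x ∷ xs) = cong (f x ∙_) (sum-lookup f xs)

  sum-++ : (f : A → Carrier) (xs : Vector A m) (ys : Vector A n) →
    sum (f ∘ (xs Vector.++ ys)) ≈ sum (f ∘ xs) ∙ sum (f ∘ ys)
  sum-++ {m = zero}  f xs ys = ≈-sym (identityˡ _)
  sum-++ {m = suc m} f xs ys = ≈-trans
    (∙-congˡ (≈-trans (reflexive (sum-cong-≗ split)) (sum-++ f (xs ∘ suc) ys)))
    (≈-sym (assoc (f (xs zero)) _ _))
    where
    split : ∀ i → f ((xs Vector.++ ys) (suc i)) ≡ f (((xs ∘ suc) Vector.++ ys) i)
    split i with splitAt m i
    ... | inj₁ _ = refl
    ... | inj₂ _ = refl

module ∑ℕ = CommutativeMonoidSum ℕₚ.+-0-commutativeMonoid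
module ∑ℤ = CommutativeMonoidSum ℤₚ.+-0-commutativeMonoid
module ∑ℙ = CommutativeMonoidSum ℙₚ.+-0-commutativeMonoid

sumℕ≡sum : (f : Vector ℕ m) → sumℕ f ≡ ∑ℕ.sum f
sumℕ≡sum {zero}  f = refl
sumℕ≡sum {suc m} f = cong (f 0F ℕ.+_) (sumℕ≡sum (f ∘ suc))

sumℤ≡sum : (f : Vector ℤ m) → sumℤ f ≡ ∑ℤ.sum f
sumℤ≡sum {zero}  f = refl
sumℤ≡sum {suc m} f = cong (λ s → f 0F ℤ.+ s) (sumℤ≡sum (f ∘ suc))

≤-sum : (f : Vector ℕ m) (i : Fin m) → f i ≤ ∑ℕ.sum f
≤-sum f 0F      = ℕₚ.m≤m+n (f 0F) _
≤-sum f (suc i) = ℕₚ.≤-trans (≤-sum (f ∘ suc) i) (ℕₚ.m≤n+m _ (f 0F))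

sum-mono-≤ : {f g : Vector ℕ m} → (∀ i → f i ≤ g i) → ∑ℕ.sum f ≤ ∑ℕ.sum g
sum-mono-≤ {zero}  f≤g = z≤n
sum-mono-≤ {suc m} f≤g = ℕₚ.+-mono-≤ (f≤g 0F) (sum-mono-≤ (f≤g ∘ suc))

parity-sum-cong : {f g : Vector ℕ m} → (∀ i → parity (f i) ≡ parity (g i)) →
  parity (∑ℕ.sum f) ≡ parity (∑ℕ.sum g)
parity-sum-cong {f = f} {g} same = begin
  parity (∑ℕ.sum f)       ≡⟨ parity-sum f ⟩
  ∑ℙ.sum (parity ∘ f)     ≡⟨ ∑ℙ.sum-cong-≗ same ⟩
  ∑ℙ.sum (parity ∘ g)     ≡⟨ parity-sum g ⟨
  parity (∑ℕ.sum g)       ∎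
  where
  open ≡-Reasoning
  parity-sum : (f : Vector ℕ m) → parity (∑ℕ.sum f) ≡ ∑ℙ.sum (parity ∘ f)
  parity-sum = sum-homo ℕₚ.+-0-monoid ℙₚ.+-0-monoid ℙₚ.parity-isMonoidHomomorphism

length≡∑ˡ : (xs : List A) → length xs ≡ Summation.∑ˡ ℕₚ.+-0-monoid (const 1) xs
length≡∑ˡ []       = refl
length≡∑ˡ (x ∷ xs) = cong suc (length≡∑ˡ xs)

-- Boundaries of chains

Ends : ℕ → Set ℓᵃ → Set ℓᵃ
Ends m V = Fin m → Fin 2 → V

Attached : {A : Set ℓᵃ} → Ends m (Maybe A) → Fin m → Set ℓᵃ
Attached {A = A} E e = ∀ i → Σ[ v ∈ A ] E e i ≡ just v

module Indicator {c ℓ} (S : Semiring c ℓ) {V : Set} (_≟_ : DecidableEquality V) where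
  open Semiring S hiding (refl; sym; trans)

  δ : V → V → Carrier
  δ u w = if ⌊ u ≟ w ⌋ then 1# else 0#

  δ-refl : ∀ w → δ w w ≡ 1#
  δ-refl w with w ≟ w
  ... | yes _  = refl
  ... | no w≢w = contradiction refl w≢w

  δ-≢ : ∀ {u w} → u ≢ w → δ u w ≡ 0#
  δ-≢ {u} {w} u≢w with u ≟ w
  ... | yes u≡w = contradiction u≡w u≢w
  ... | no _    = refl

  *-δ : ∀ x u w → x * δ u w ≈ (if ⌊ u ≟ w ⌋ then x else 0#)
  *-δ x u w with u ≟ w
  ... | yes _ = *-identityʳ x
  ... | no _  = zeroʳ x

module _ {c ℓ} (S : Semiring c ℓ) where
  open Semiring S renaming (trans to ≈-trans) hiding (refl; sym)
  open SemiringSum S using (sum)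

  sum-δ : (a : Fin n) → sum (λ v → Indicator.δ S _≟ᵐ_ (just a) (just v)) ≈ 1#
  sum-δ a = ≈-trans
    (sum-supported-at +-commutativeMonoid _ a λ v v≢a → reflexive (δ-≢ (v≢a ∘ sym ∘ just-injective)))
    (reflexive (δ-refl (just a)))
    where open Indicator S _≟ᵐ_

module Boundary {c ℓ} (R : Ring c ℓ) {V : Set} (_≟_ : DecidableEquality V) where
  open Ring R renaming (trans to ≈-trans) hiding (refl; sym)
  open SemiringSum semiring
  open Indicator semiring _≟_ public

  incidence : Ends m V → V → Vector Carrier m
  incidence E w e = δ (E e 1F) w - δ (E e 0F) w

  ∂ : Ends m V → Vector Carrier m → V → Carrier
  ∂ E x w = sum λ e → x e * incidence E w e

  IsCycle : Ends m V → Vector Carrier m → Set ℓ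
  IsCycle E x = ∀ w → ∂ E x w ≈ 0#

  ∂-cong : (E : Ends m V) {x y : Vector Carrier m} → (∀ e → x e ≈ y e) → ∀ w → ∂ E x w ≈ ∂ E y w
  ∂-cong E x≈y w = sum-cong-≋ λ e → *-congʳ (x≈y e)

  ∂-+ : (E : Ends m V) (x y : Vector Carrier m) → ∀ w → ∂ E (λ e → x e + y e) w ≈ ∂ E x w + ∂ E y w
  ∂-+ E x y w = ≈-trans (sum-cong-≋ λ e → distribʳ (incidence E w e) (x e) (y e))
    (∑-distrib-+ (λ e → x e * incidence E w e) (λ e → y e * incidence E w e))

  cycle-+ : (E : Ends m V) (x y : Vector Carrier m) → IsCycle E x → IsCycle E y →
    IsCycle E (λ e → x e + y e)
  cycle-+ E x y x-cycle y-cycle w =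
    ≈-trans (∂-+ E x y w) (≈-trans (+-cong (x-cycle w) (y-cycle w)) (+-identityˡ 0#))

  ∂-off-support : (E : Ends m V) (x : Vector Carrier m) {w : V} →
    (∀ e → x e ≈ 0# ⊎ (∀ i → E e i ≢ w)) → ∂ E x w ≈ 0#
  ∂-off-support {m} E x {w} away = ≈-trans (sum-cong-≋ vanishes) (sum-replicate-zero m)
    where
    vanishes : ∀ e → x e * incidence E w e ≈ 0#
    vanishes e with away e
    ... | inj₁ zero-on-e = ≈-trans (*-congʳ zero-on-e) (zeroˡ _)
    ... | inj₂ not-at-w rewrite δ-≢ (not-at-w 1F) | δ-≢ (not-at-w 0F) =
      ≈-trans (*-congˡ (-‿inverseʳ 0#)) (zeroʳ (x e))

module _ {c ℓ} (R : Ring c ℓ) where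
  open Ring R renaming (sym to ≈-sym; trans to ≈-trans) hiding (refl)
  open SemiringSum semiring
  open RingProperties R using (-1*x≈-x)

  module _ {n : ℕ} where
    open Boundary R (_≟ᵐ_ {n})

    sum-δ-minus : (a b : Fin n) → sum (λ v → δ (just b) (just v) - δ (just a) (just v)) ≈ 0#
    sum-δ-minus a b = begin
      sum (λ v → δb v - δa v)             ≈⟨ ∑-distrib-+ δb (λ v → - δa v) ⟩
      sum δb + sum (λ v → - δa v)         ≈⟨ +-congˡ (sum-cong-≋ (λ v → -1*x≈-x (δa v))) ⟨
      sum δb + sum (λ v → - 1# * δa v)    ≈⟨ +-congˡ (*-distribˡ-sum (- 1#) δa) ⟨
      sum δb + - 1# * sum δa              ≈⟨ +-cong (sum-δ semiring b) (*-congˡ (sum-δ semiring a)) ⟩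
      1# + - 1# * 1#                      ≈⟨ +-congˡ (*-identityʳ (- 1#)) ⟩
      1# - 1#                             ≈⟨ -‿inverseʳ 1# ⟩
      0#                                  ∎
      where
      open ≈-Reasoning setoid
      δa δb : Vector Carrier n
      δa v = δ (just a) (just v)
      δb v = δ (just b) (just v)

    module _ (E : Ends m (Maybe (Fin n))) (closed : ∀ e → Attached E e) (x : Vector Carrier m) where

      closed-cycle : (∀ v → ∂ E x (just v) ≈ 0#) → IsCycle E x
      closed-cycle cycle (just v) = cycle v
      closed-cycle cycle nothing  =
        ∂-off-support E x λ e → inj₂ λ i p → contradiction (trans (sym p) (proj₂ (closed e i))) λ ()

      sum-∂ : sum (λ v → ∂ E x (just v)) ≈ 0#
      sum-∂ = ≈-trans (∑-comm λ v e → x e * incidence E (just v) e)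
        (≈-trans (sum-cong-≋ balanced) (sum-replicate-zero m))
        where
        balanced : ∀ e → sum (λ v → x e * incidence E (just v) e) ≈ 0#
        balanced e with a , p ← closed e 0F | b , q ← closed e 1F rewrite p | q = ≈-trans
          (≈-sym (*-distribˡ-sum (x e) (λ v → δ (just b) (just v) - δ (just a) (just v))))
          (≈-trans (*-congˡ (sum-δ-minus a b)) (zeroʳ (x e)))

      ∂-zero-elsewhere⇒zero : (p : Fin n) → (∀ v → v ≢ p → ∂ E x (just v) ≈ 0#) → ∂ E x (just p) ≈ 0#
      ∂-zero-elsewhere⇒zero p elsewhere =
        ≈-trans (≈-sym (sum-supported-at +-commutativeMonoid (∂ E x ∘ just) p elsewhere)) sum-∂

module _ {a b ℓ₁ ℓ₂} (R : Ring a ℓ₁) (S : Ring b ℓ₂) {V : Set} (_≟_ : DecidableEquality V) where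
  private
    module R = Ring R
    module S = Ring S
    module ∂R = Boundary R _≟_
    module ∂S = Boundary S _≟_
  open RingMorphisms R.rawRing S.rawRing using (IsRingHomomorphism)

  module _ {h : R.Carrier → S.Carrier} (h-homo : IsRingHomomorphism h) where
    open IsRingHomomorphism h-homo

    δ-homo : ∀ u w → h (∂R.δ u w) S.≈ ∂S.δ u w
    δ-homo u w with u ≟ w
    ... | yes _ = 1#-homo
    ... | no _  = 0#-homo

    incidence-homo : (E : Ends m V) → ∀ w e → h (∂R.incidence E w e) S.≈ ∂S.incidence E w e
    incidence-homo E w e = S.trans (+-homo (∂R.δ (E e 1F) w) _)
      (S.+-cong (δ-homo _ w) (S.trans (-‿homo _) (S.-‿cong (δ-homo _ w))))

    ∂-homo : (E : Ends m V) (x : Vector R.Carrier m) → ∀ w → h (∂R.∂ E x w) S.≈ ∂S.∂ E (h ∘ x) w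
    ∂-homo E x w = S.trans
      (sum-homo R.+-monoid S.+-monoid +-isMonoidHomomorphism (λ e → x e R.* ∂R.incidence E w e))
      (SemiringSum.sum-cong-≋ S.semiring λ e → begin
        h (x e R.* ∂R.incidence E w e)      ≈⟨ *-homo (x e) _ ⟩
        h (x e) S.* h (∂R.incidence E w e)  ≈⟨ S.*-congˡ (incidence-homo E w e) ⟩
        h (x e) S.* ∂S.incidence E w e      ∎)
      where open ≈-Reasoning S.setoid

-- Parity of integers

parityℤ : ℤ → Parity
parityℤ = parity ∘ ∣_∣

parityℤ-⊖ : ∀ a b → parityℤ (a ⊖ b) ≡ parity a ℙ.+ parity b
parityℤ-⊖ a       zero    = sym (ℙₚ.+-identityʳ (parity a))
parityℤ-⊖ zero    (suc b) = refl
parityℤ-⊖ (suc a) (suc b) = begin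
  parityℤ (suc a ⊖ suc b)                    ≡⟨ cong parityℤ (ℤₚ.[1+m]⊖[1+n]≡m⊖n a b) ⟩
  parityℤ (a ⊖ b)                            ≡⟨ parityℤ-⊖ a b ⟩
  parity a ℙ.+ parity b                      ≡⟨ cong₂ ℙ._+_ (ℙₚ.suc-homo-⁻¹ a) (ℙₚ.suc-homo-⁻¹ b) ⟨
  parity (suc a) ⁻¹ ℙ.+ parity (suc b) ⁻¹    ≡⟨ ⁻¹+⁻¹ (parity (suc a)) (parity (suc b)) ⟩
  parity (suc a) ℙ.+ parity (suc b)          ∎
  where
  open ≡-Reasoning
  ⁻¹+⁻¹ : ∀ p q → p ⁻¹ ℙ.+ q ⁻¹ ≡ p ℙ.+ q
  ⁻¹+⁻¹ 0ℙ 0ℙ = refl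
  ⁻¹+⁻¹ 0ℙ 1ℙ = refl
  ⁻¹+⁻¹ 1ℙ 0ℙ = refl
  ⁻¹+⁻¹ 1ℙ 1ℙ = refl

parityℤ-+ : ∀ i j → parityℤ (i ℤ.+ j) ≡ parityℤ i ℙ.+ parityℤ j
parityℤ-+ (ℤ.+ a)  (ℤ.+ b)  = ℙₚ.+-homo-+ a b
parityℤ-+ (ℤ.+ a)  -[1+ b ] = parityℤ-⊖ a (suc b)
parityℤ-+ -[1+ a ] (ℤ.+ b)  = trans (parityℤ-⊖ b (suc a)) (ℙₚ.+-comm (parity b) (parity (suc a)))
parityℤ-+ -[1+ a ] -[1+ b ] =
  trans (cong (parity ∘ suc) (sym (ℕₚ.+-suc a b))) (ℙₚ.+-homo-+ (suc a) (suc b))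

parityℤ-isRingHomomorphism :
  RingMorphisms.IsRingHomomorphism (Ring.rawRing ℤₚ.+-*-ring) (Ring.rawRing ℙₚ.+-*-ring) parityℤ
parityℤ-isRingHomomorphism = record
  { isSemiringHomomorphism = record
    { isNearSemiringHomomorphism = record
      { +-isMonoidHomomorphism = record
        { isMagmaHomomorphism = record
          { isRelHomomorphism = record { cong = cong parityℤ }
          ; homo              = parityℤ-+
          }
        ; ε-homo = refl
        }
      ; *-homo = λ i j → trans (cong parity (ℤₚ.abs-* i j)) (ℙₚ.*-homo-* ∣ i ∣ ∣ j ∣)
      }
    ; 1#-homo = refl
    }
  ; -‿homo = λ i → cong parity (ℤₚ.∣-i∣≡∣i∣ i)
  }

even⇒doubleℕ : ∀ k → parity k ≡ 0ℙ → ∃ λ h → k ≡ h ℕ.+ h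
even⇒doubleℕ zero          _    = 0 , refl
even⇒doubleℕ (suc (suc k)) even with h , eq ← even⇒doubleℕ k even =
  suc h , cong suc (trans (cong suc eq) (sym (ℕₚ.+-suc h h)))

even⇒double : ∀ i → parityℤ i ≡ 0ℙ → ∃ λ j → i ≡ j ℤ.+ j
even⇒double (ℤ.+ k)  even with h , eq ← even⇒doubleℕ k even = ℤ.+ h , cong ℤ.+_ eq
even⇒double -[1+ k ] even with h , eq ← even⇒doubleℕ (suc k) even =
  ℤ.- (ℤ.+ h) , trans (cong (λ l → ℤ.- (ℤ.+ l)) eq) (ℤₚ.neg-distrib-+ (ℤ.+ h) (ℤ.+ h))

-- Lifting chains from ℤ₂ to {-1, 0, 1}

∀-punchIn : (j : Fin (suc n)) {P : Fin (suc n) → Set} → P j → (∀ k → P (punchIn j k)) → ∀ i → P i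
∀-punchIn j {P} at-j elsewhere i with j ≟ᶠ i
... | yes refl = at-j
... | no j≢i   = subst P (punchIn-punchOut j≢i) (elsewhere (punchOut j≢i))

module _ {V : Set} (_≟_ : DecidableEquality V) where
  open Boundary ℤₚ.+-*-ring _≟_ using () renaming (δ to δℤ; incidence to incidenceℤ; ∂ to ∂ℤ)
  open Boundary ℙₚ.+-*-ring _≟_ using (δ-refl; δ-≢; ∂-off-support)
    renaming (δ to δℙ; incidence to incidenceℙ; ∂ to ∂ℙ; IsCycle to IsCycleℙ)
  open ≡-Reasoning

  record UnitLift (E : Ends m V) (p : Vector Parity m) (β : V → ℤ) : Set where
    field
      chain    : Vector ℤ m
      unit     : ∀ e → ∣ chain e ∣ ≤ 1
      lifts    : ∀ e → parityℤ (chain e) ≡ p e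
      boundary : ∀ w → ∂ℤ E chain w ≡ β w

  extend-lift : (E : Ends (suc m) V) (p : Vector Parity (suc m)) {β β′ : V → ℤ}
    (j : Fin (suc m)) (ε : ℤ) →
    ∣ ε ∣ ≤ 1 → parityℤ ε ≡ p j → (∀ w → ε ℤ.* incidenceℤ E w j ℤ.+ β′ w ≡ β w) →
    UnitLift (removeAt E j) (removeAt p j) β′ → UnitLift E p β
  extend-lift {m} E p {β} {β′} j ε small parity-ε β-split lift = record
    { chain    = y
    ; unit     = ∀-punchIn j (subst (λ i → ∣ i ∣ ≤ 1) (sym (insertAt-lookup chain j ε)) small)
                   λ k → subst (λ i → ∣ i ∣ ≤ 1) (sym (insertAt-punchIn chain j ε k)) (unit k)
    ; lifts    = ∀-punchIn j (trans (cong parityℤ (insertAt-lookup chain j ε)) parity-ε)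
                   λ k → trans (cong parityℤ (insertAt-punchIn chain j ε k)) (lifts k)
    ; boundary = λ w → begin
        ∂ℤ E y w
          ≡⟨ ∑ℤ.sum-remove {i = j} (λ e → y e ℤ.* incidenceℤ E w e) ⟩
        y j ℤ.* incidenceℤ E w j ℤ.+ ∂ℤ (removeAt E j) (removeAt y j) w
          ≡⟨ cong₂ (λ i s → i ℤ.* incidenceℤ E w j ℤ.+ s) (insertAt-lookup chain j ε)
               (∂-cong (removeAt E j) (insertAt-punchIn chain j ε) w) ⟩
        ε ℤ.* incidenceℤ E w j ℤ.+ ∂ℤ (removeAt E j) chain w
          ≡⟨ cong (λ s → ε ℤ.* incidenceℤ E w j ℤ.+ s) (boundary w) ⟩
        ε ℤ.* incidenceℤ E w j ℤ.+ β′ w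
          ≡⟨ β-split w ⟩
        β w ∎
    }
    where
    open UnitLift lift
    open Boundary ℤₚ.+-*-ring _≟_ using (∂-cong)
    y : Vector ℤ (suc m)
    y = insertAt chain j ε

  odd-boundary⇒odd-edge : (E : Ends m V) (p : Vector Parity m) {w : V} → ∂ℙ E p w ≡ 1ℙ →
    ∃ λ e → ∃ λ i → p e ≡ 1ℙ × E e i ≡ w
  odd-boundary⇒odd-edge E p {w} odd with any? (λ e → any? λ i → (p e ℙₚ.≟ 1ℙ) ×-dec (E e i ≟ w))
  ... | yes found = found
  ... | no none   = contradiction (trans (sym odd) (∂-off-support E p away)) λ ()
    where
    away : ∀ e → p e ≡ 0ℙ ⊎ (∀ i → E e i ≢ w)
    away e with p e in p-e
    ... | 0ℙ = inj₁ refl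
    ... | 1ℙ = inj₂ λ i at-w → none (e , i , p-e , at-w)

  sign : Fin 2 → ℤ
  sign 0F = 1ℤ
  sign 1F = -1ℤ

  sign*incidence : (E : Ends m V) → ∀ w e i →
    sign i ℤ.* incidenceℤ E w e ≡ δℤ (E e (swap2 i)) w ℤ.- δℤ (E e i) w
  sign*incidence E w e 0F = ℤₚ.*-identityˡ _
  sign*incidence E w e 1F = reverse (δℤ (E e 1F) w) (δℤ (E e 0F) w)
    where
    reverse : ∀ t s → -1ℤ ℤ.* (t ℤ.- s) ≡ s ℤ.- t
    reverse = solve-∀

  incidenceℙ-swap : (E : Ends m V) → ∀ w e i → incidenceℙ E w e ≡ δℙ (E e (swap2 i)) w ℙ.+ δℙ (E e i) w
  incidenceℙ-swap E w e 0F = refl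
  incidenceℙ-swap E w e 1F = ℙₚ.+-comm (δℙ (E e 1F) w) _

  ∂ℙ-removeAt : (E : Ends (suc m) V) (p : Vector Parity (suc m)) (j : Fin (suc m)) → ∀ w →
    ∂ℙ (removeAt E j) (removeAt p j) w ≡ (p j ℙ.* incidenceℙ E w j) ℙ.+ ∂ℙ E p w
  ∂ℙ-removeAt E p j w = begin
    rest                       ≡⟨ cong (ℙ._+ rest) (ℙₚ.p+p≡0ℙ edge) ⟨
    (edge ℙ.+ edge) ℙ.+ rest   ≡⟨ ℙₚ.+-assoc edge edge rest ⟩
    edge ℙ.+ (edge ℙ.+ rest)
      ≡⟨ cong (edge ℙ.+_) (∑ℙ.sum-remove {i = j} (λ e → p e ℙ.* incidenceℙ E w e)) ⟨
    edge ℙ.+ ∂ℙ E p w          ∎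
    where
    edge rest : Parity
    edge = p j ℙ.* incidenceℙ E w j
    rest = ∂ℙ (removeAt E j) (removeAt p j) w

  IsTrail : Ends m V → Vector Parity m → V → V → Set
  IsTrail E p a b = ∀ w → ∂ℙ E p w ≡ δℙ a w ℙ.+ δℙ b w

  open-trail-odd : (E : Ends m V) (p : Vector Parity m) {a b : V} → a ≢ b → IsTrail E p a b →
    ∂ℙ E p a ≡ 1ℙ
  open-trail-odd E p {a} a≢b trail = trans (trail a) (cong₂ ℙ._+_ (δ-refl a) (δ-≢ (a≢b ∘ sym)))

  TrailLift : Ends m V → Vector Parity m → V → V → Set
  TrailLift E p a b = UnitLift E p λ w → δℤ b w ℤ.- δℤ a w

  -- An open trail from a to b starts with an odd edge at a; without this edge it is a trail
  -- from the other end of the edge to b.  A closed trail with an odd edge opens up at that edge.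
  lift-cycle : (E : Ends m V) (p : Vector Parity m) → IsCycleℙ E p → UnitLift E p (const 0ℤ)
  lift-trail : (E : Ends m V) (p : Vector Parity m) (a b : V) → IsTrail E p a b → TrailLift E p a b
  lift-open-trail : (E : Ends m V) (p : Vector Parity m) (a b : V) → a ≢ b → IsTrail E p a b →
    TrailLift E p a b

  lift-cycle {zero}  E p cycle = record
    { chain = λ () ; unit = λ () ; lifts = λ () ; boundary = λ _ → refl }
  lift-cycle {suc m} E p cycle with p 0F in p₀ | rest
    where
    rest : ∀ w → ∂ℙ (E ∘ suc) (p ∘ suc) w ≡ p 0F ℙ.* incidenceℙ E w 0F
    rest w = trans (∂ℙ-removeAt E p 0F w)
      (trans (cong ((p 0F ℙ.* incidenceℙ E w 0F) ℙ.+_) (cycle w)) (ℙₚ.+-identityʳ _))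
  ... | 0ℙ | rest-cycle = extend-lift E p 0F 0ℤ z≤n (sym p₀) (λ _ → refl)
    (lift-cycle (E ∘ suc) (p ∘ suc) rest-cycle)
  ... | 1ℙ | rest-trail = extend-lift E p 0F 1ℤ (s≤s z≤n) (sym p₀)
    (λ w → closes-up (δℤ (E 0F 1F) w) (δℤ (E 0F 0F) w))
    (lift-trail (E ∘ suc) (p ∘ suc) (E 0F 1F) (E 0F 0F) rest-trail)
    where
    closes-up : ∀ t s → 1ℤ ℤ.* (t ℤ.- s) ℤ.+ (s ℤ.- t) ≡ 0ℤ
    closes-up = solve-∀

  lift-trail E p a b trail with a ≟ b
  ... | no a≢b   = lift-open-trail E p a b a≢b trail
  ... | yes refl = record
    { UnitLift lift hiding (boundary)
    ; boundary = λ w → trans (UnitLift.boundary lift w) (sym (ℤₚ.+-inverseʳ (δℤ a w))) }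
    where
    lift : UnitLift E p (const 0ℤ)
    lift = lift-cycle E p λ w → trans (trail w) (ℙₚ.p+p≡0ℙ (δℙ a w))

  lift-open-trail {zero}  E p a b a≢b trail
    with () ← open-trail-odd E p a≢b trail
  lift-open-trail {suc m} E p a b a≢b trail
    with j , i , odd , refl ← odd-boundary⇒odd-edge E p (open-trail-odd E p a≢b trail)
    = extend-lift E p j (sign i) (unit-sign i) (trans (odd-sign i) (sym odd))
        (λ w → trans (cong (ℤ._+ (δℤ b w ℤ.- δℤ z w)) (sign*incidence E w j i))
                     (telescope (δℤ z w) (δℤ a w) (δℤ b w)))
        (lift-trail (removeAt E j) (removeAt p j) z b λ w → begin
          ∂ℙ (removeAt E j) (removeAt p j) w
            ≡⟨ ∂ℙ-removeAt E p j w ⟩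
          (p j ℙ.* incidenceℙ E w j) ℙ.+ ∂ℙ E p w
            ≡⟨ cong₂ ℙ._+_ (cong₂ ℙ._*_ odd (incidenceℙ-swap E w j i)) (trail w) ⟩
          (δℙ z w ℙ.+ δℙ a w) ℙ.+ (δℙ a w ℙ.+ δℙ b w)
            ≡⟨ telescopeℙ (δℙ z w) (δℙ a w) (δℙ b w) ⟩
          δℙ z w ℙ.+ δℙ b w ∎)
    where
    z : V
    z = E j (swap2 i)
    unit-sign : ∀ i → ∣ sign i ∣ ≤ 1
    unit-sign 0F = s≤s z≤n
    unit-sign 1F = s≤s z≤n
    odd-sign : ∀ i → parityℤ (sign i) ≡ 1ℙ
    odd-sign 0F = refl
    odd-sign 1F = refl
    telescope : ∀ z a b → (z ℤ.- a) ℤ.+ (b ℤ.- z) ≡ b ℤ.- a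
    telescope = solve-∀
    telescopeℙ : ∀ z a b → (z ℙ.+ a) ℙ.+ (a ℙ.+ b) ≡ z ℙ.+ b
    telescopeℙ z a b = begin
      (z ℙ.+ a) ℙ.+ (a ℙ.+ b)  ≡⟨ ℙₚ.+-assoc z a (a ℙ.+ b) ⟩
      z ℙ.+ (a ℙ.+ (a ℙ.+ b))  ≡⟨ cong (z ℙ.+_) (ℙₚ.+-assoc a a b) ⟨
      z ℙ.+ ((a ℙ.+ a) ℙ.+ b)  ≡⟨ cong (λ q → z ℙ.+ (q ℙ.+ b)) (ℙₚ.p+p≡0ℙ a) ⟩
      z ℙ.+ b                  ∎

-- Darts at a vertex

Dart : ℕ → Set
Dart m = Fin m × Fin 2

darts : ∀ m → List (Dart m)
darts m = cartesianProduct (allFin m) (allFin 2)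

∈-darts : (d : Dart m) → d ∈ darts m
∈-darts (e , i) = ∈-cartesianProduct⁺ (∈-allFin e) (∈-allFin i)

darts-unique : ∀ m → Unique (darts m)
darts-unique m = Unique.cartesianProduct⁺ (Unique.allFin⁺ m) (Unique.allFin⁺ 2)

module _ {c ℓ} (M : Monoid c ℓ) where
  open Monoid M renaming (trans to ≈-trans) hiding (refl; sym)
  open MonoidSum M
  open Summation M

  ∑ˡ-darts : (f : Dart m → Carrier) → ∑ˡ f (darts m) ≈ sum λ e → sum λ i → f (e , i)
  ∑ˡ-darts {m} f = ≈-trans (∑ˡ-cartesianProduct f (allFin m) (allFin 2)) (reflexive (trans
    (∑ˡ-tabulate (λ e → ∑ˡ (λ i → f (e , i)) (allFin 2)) id)
    (sum-cong-≗ λ e → ∑ˡ-tabulate (λ i → f (e , i)) id)))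

module _ {V : Set} (_≟_ : DecidableEquality V) where

  incident : Ends m V → V → List (Dart m)
  incident {m} E w = filter (λ (e , i) → E e i ≟ w) (darts m)

  ∈-incident⁺ : (E : Ends m V) {w : V} → ∀ {e i} → E e i ≡ w → (e , i) ∈ incident E w
  ∈-incident⁺ E {w} at-w = ∈-filter⁺ (λ (e , i) → E e i ≟ w) (∈-darts _) at-w

  ∈-incident⁻ : (E : Ends m V) {w : V} → ∀ {e i} → (e , i) ∈ incident E w → E e i ≡ w
  ∈-incident⁻ {m} E {w} = proj₂ ∘ ∈-filter⁻ (λ (e , i) → E e i ≟ w) {xs = darts m}

  incident-unique : (E : Ends m V) (w : V) → Unique (incident E w)
  incident-unique {m} E w = Unique.filter⁺ (λ (e , i) → E e i ≟ w) (darts-unique m)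

  module _ {c ℓ} (M : Monoid c ℓ) where
    open Monoid M renaming (trans to ≈-trans) hiding (refl; sym)
    open MonoidSum M
    open Summation M

    ∑ˡ-incident : (E : Ends m V) (w : V) (f : Dart m → Carrier) →
      ∑ˡ f (incident E w) ≈ sum λ e → sum λ i → if ⌊ E e i ≟ w ⌋ then f (e , i) else ε
    ∑ˡ-incident {m} E w f = ≈-trans (∑ˡ-filter (λ (e , i) → E e i ≟ w) f (darts m))
      (∑ˡ-darts M λ (e , i) → if ⌊ E e i ≟ w ⌋ then f (e , i) else ε)

  ∂ℙ≡∑ˡ-incident : (E : Ends m V) (p : Vector Parity m) (w : V) →
    Boundary.∂ ℙₚ.+-*-ring _≟_ E p w ≡ Summation.∑ˡ ℙₚ.+-0-monoid (p ∘ proj₁) (incident E w)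
  ∂ℙ≡∑ˡ-incident E p w = sym (trans (∑ˡ-incident ℙₚ.+-0-monoid E w (p ∘ proj₁)) (sum-cong-≗ at-edge))
    where
    open ∑ℙ using (sum; sum-cong-≗)
    open Boundary ℙₚ.+-*-ring _≟_
    open ≡-Reasoning
    at-edge : ∀ e → (sum λ i → if ⌊ E e i ≟ w ⌋ then p e else 0ℙ) ≡ p e ℙ.* incidence E w e
    at-edge e = begin
      sum (λ i → if ⌊ E e i ≟ w ⌋ then p e else 0ℙ)
        ≡⟨ sum-cong-≗ (λ i → *-δ (p e) (E e i) w) ⟨
      sum (λ i → p e ℙ.* δ (E e i) w)
        ≡⟨ cong ((p e ℙ.* δ (E e 0F) w) ℙ.+_) (ℙₚ.+-identityʳ _) ⟩
      (p e ℙ.* δ (E e 0F) w) ℙ.+ (p e ℙ.* δ (E e 1F) w)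
        ≡⟨ ℙₚ.*-distribˡ-+ (p e) (δ (E e 0F) w) (δ (E e 1F) w) ⟨
      p e ℙ.* (δ (E e 0F) w ℙ.+ δ (E e 1F) w)
        ≡⟨ cong (p e ℙ.*_) (ℙₚ.+-comm (δ (E e 0F) w) _) ⟩
      p e ℙ.* incidence E w e ∎

module _ {V W : Set} (_≟ⱽ_ : DecidableEquality V) (_≟ᵂ_ : DecidableEquality W)
  (E : Ends m V) (E′ : Ends m W) {v : V} {w : W} (same : ∀ e i → E e i ≡ v ⇔ E′ e i ≡ w) where

  incident-cong : incident _≟ⱽ_ E v ≡ incident _≟ᵂ_ E′ w
  incident-cong = filter-≐ (λ (e , i) → E e i ≟ⱽ v) (λ (e , i) → E′ e i ≟ᵂ w)
    ((λ {(e , i)} → Equivalence.to (same e i)) , λ {(e , i)} → Equivalence.from (same e i)) (darts m)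

  open Boundary ℙₚ.+-*-ring using (∂)

  ∂ℙ-cong-ends : (p : Vector Parity m) → ∂ _≟ⱽ_ E p v ≡ ∂ _≟ᵂ_ E′ p w
  ∂ℙ-cong-ends p = begin
    ∂ _≟ⱽ_ E p v                            ≡⟨ ∂ℙ≡∑ˡ-incident _≟ⱽ_ E p v ⟩
    ∑ˡ (p ∘ proj₁) (incident _≟ⱽ_ E v)      ≡⟨ cong (∑ˡ (p ∘ proj₁)) incident-cong ⟩
    ∑ˡ (p ∘ proj₁) (incident _≟ᵂ_ E′ w)     ≡⟨ ∂ℙ≡∑ˡ-incident _≟ᵂ_ E′ p w ⟨
    ∂ _≟ᵂ_ E′ p w                           ∎
    where
    open ≡-Reasoning
    open Summation ℙₚ.+-0-monoid using (∑ˡ)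

module _ where
  open ≡-Reasoning
  open Indicator ℕₚ.+-*-semiring using (δ)
  open ∑ℕ
  open Summation ℕₚ.+-0-monoid using (∑ˡ)

  deg≡sum-δ : ∀ G v → deg G v ≡ sum λ e → sum λ i → δ _≟ᵐ_ (end G e i) (just v)
  deg≡sum-δ G v = trans (sumℕ≡sum (sumℕ ∘ at-end)) (sum-cong-≗ (sumℕ≡sum ∘ at-end))
    where
    at-end : Ends (nE G) ℕ
    at-end e i = δ _≟ᵐ_ (end G e i) (just v)

  deg≡length-incident : ∀ G v → deg G v ≡ length (incident _≟ᵐ_ (end G) (just v))
  deg≡length-incident G v = begin
    deg G v
      ≡⟨ deg≡sum-δ G v ⟩
    sum (λ e → sum λ i → δ _≟ᵐ_ (end G e i) (just v))
      ≡⟨ ∑ˡ-incident _≟ᵐ_ ℕₚ.+-0-monoid (end G) (just v) (const 1) ⟨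
    ∑ˡ (const 1) (incident _≟ᵐ_ (end G) (just v))
      ≡⟨ length≡∑ˡ (incident _≟ᵐ_ (end G) (just v)) ⟨
    length (incident _≟ᵐ_ (end G) (just v)) ∎

-- Colours as the nonzero elements of ℤ₂ × ℤ₂

bit : Fin 2 → Fin 3 → Parity
bit 0F 0F = 1ℙ
bit 0F 1F = 0ℙ
bit 0F 2F = 1ℙ
bit 1F 0F = 0ℙ
bit 1F 1F = 1ℙ
bit 1F 2F = 1ℙ

colour : Parity → Parity → Fin 3
colour 1ℙ 0ℙ = 0F
colour 0ℙ _  = 1F
colour 1ℙ 1ℙ = 2F

bit-colour : ∀ p q → p ≡ 1ℙ ⊎ q ≡ 1ℙ → bit 0F (colour p q) ≡ p × bit 1F (colour p q) ≡ q
bit-colour 0ℙ 1ℙ _ = refl , refl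
bit-colour 1ℙ 0ℙ _ = refl , refl
bit-colour 1ℙ 1ℙ _ = refl , refl
bit-colour 0ℙ 0ℙ (inj₁ ())
bit-colour 0ℙ 0ℙ (inj₂ ())

colour-nonzero : ∀ k → bit 0F k ≡ 1ℙ ⊎ bit 1F k ≡ 1ℙ
colour-nonzero 0F = inj₁ refl
colour-nonzero 1F = inj₂ refl
colour-nonzero 2F = inj₁ refl

module _ where
  open Summation ℙₚ.+-0-monoid using (∑ˡ)

  ZeroSum : List (Fin 3) → Set
  ZeroSum ks = ∀ b → ∑ˡ (bit b) ks ≡ 0ℙ

  unique⇔zero-sum : ∀ ks → length ks ≡ 3 → Unique ks ⇔ ZeroSum ks
  unique⇔zero-sum (k ∷ l ∷ m ∷ []) refl = let to , from = by-cases k l m in mk⇔ to from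
    where
    unique? : (ks : List (Fin 3)) → Dec (Unique ks)
    unique? = allPairs? λ k l → ¬? (k ≟ᶠ l)
    zero-sum? : (ks : List (Fin 3)) → Dec (ZeroSum ks)
    zero-sum? ks = all? λ b → ∑ˡ (bit b) ks ℙₚ.≟ 0ℙ
    by-cases : ∀ k l m → let ks = k ∷ l ∷ m ∷ [] in (Unique ks → ZeroSum ks) × (ZeroSum ks → Unique ks)
    by-cases = from-yes (all? λ k → all? λ l → all? λ m → let ks = k ∷ l ∷ m ∷ [] in
      (unique? ks →-dec zero-sum? ks) ×-dec (zero-sum? ks →-dec unique? ks))

-- Proper colourings

∈-map-allPairs : {R S : A → A → Set} {xs : List A} → (∀ {x y} → x ∈ xs → y ∈ xs → R x y → S x y) →
  AllPairs R xs → AllPairs S xs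
∈-map-allPairs R⇒S []         = []
∈-map-allPairs R⇒S (Rx ∷ Rxs) =
  All.tabulate (λ y∈xs → R⇒S (here refl) (there y∈xs) (All.lookup Rx y∈xs)) ∷
  ∈-map-allPairs (λ x∈xs y∈xs → R⇒S (there x∈xs) (there y∈xs)) Rxs

allPairs-lookup : {R : A → A → Set} {xs : List A} → Symmetric R → AllPairs R xs →
  ∀ {x y} → x ∈ xs → y ∈ xs → x ≢ y → R x y
allPairs-lookup R-sym (Rx ∷ Rxs) (here refl)  (here refl)  x≢y = contradiction refl x≢y
allPairs-lookup R-sym (Rx ∷ Rxs) (here refl)  (there y∈xs) x≢y = All.lookup Rx y∈xs
allPairs-lookup R-sym (Rx ∷ Rxs) (there x∈xs) (here refl)  x≢y = R-sym (All.lookup Rx x∈xs)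
allPairs-lookup R-sym (Rx ∷ Rxs) (there x∈xs) (there y∈xs) x≢y = allPairs-lookup R-sym Rxs x∈xs y∈xs x≢y

ProperAt : {V : Set} → Ends m V → Vector (Fin 3) m → V → Set
ProperAt E c w = ∀ e i e′ i′ → (e , i) ≢ (e′ , i′) → E e i ≡ w → E e′ i′ ≡ w → c e ≢ c e′

module _ {V : Set} (_≟_ : DecidableEquality V) where
  open Boundary ℙₚ.+-*-ring _≟_ using () renaming (∂ to ∂ℙ)
  open Summation ℙₚ.+-0-monoid using (∑ˡ; ∑ˡ-map)

  KleinAt : Ends m V → Vector (Fin 3) m → V → Set
  KleinAt E c w = ∀ b → ∂ℙ E (bit b ∘ c) w ≡ 0ℙ

  coloursAt : Ends m V → Vector (Fin 3) m → V → List (Fin 3)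
  coloursAt E c w = List.map (c ∘ proj₁) (incident _≟_ E w)

  proper⇔unique : (E : Ends m V) (c : Vector (Fin 3) m) (w : V) →
    ProperAt E c w ⇔ Unique (coloursAt E c w)
  proper⇔unique E c w = mk⇔
    (λ proper → AllPairs.map⁺ (∈-map-allPairs
      (λ d∈ d′∈ d≢d′ → proper _ _ _ _ d≢d′ (∈-incident⁻ _≟_ E d∈) (∈-incident⁻ _≟_ E d′∈))
      (incident-unique _≟_ E w)))
    (λ unique e i e′ i′ d≢d′ at-w at-w′ → allPairs-lookup (λ c≢c′ → c≢c′ ∘ sym) (AllPairs.map⁻ unique)
      (∈-incident⁺ _≟_ E at-w) (∈-incident⁺ _≟_ E at-w′) d≢d′)

  klein⇔zero-sum : (E : Ends m V) (c : Vector (Fin 3) m) (w : V) →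
    KleinAt E c w ⇔ ZeroSum (coloursAt E c w)
  klein⇔zero-sum E c w = mk⇔ (λ klein b → trans (sym (∂ℙ-bit b)) (klein b))
                             (λ zero-sum b → trans (∂ℙ-bit b) (zero-sum b))
    where
    ∂ℙ-bit : ∀ b → ∂ℙ E (bit b ∘ c) w ≡ ∑ˡ (bit b) (coloursAt E c w)
    ∂ℙ-bit b = trans (∂ℙ≡∑ˡ-incident _≟_ E (bit b ∘ c) w)
      (sym (∑ˡ-map (bit b) (c ∘ proj₁) (incident _≟_ E w)))

  proper⇔klein : (E : Ends m V) (c : Vector (Fin 3) m) (w : V) → length (incident _≟_ E w) ≡ 3 →
    ProperAt E c w ⇔ KleinAt E c w
  proper⇔klein E c w cubic = ⇔-trans (proper⇔unique E c w) (⇔-trans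
    (unique⇔zero-sum (coloursAt E c w) (trans (length-map (c ∘ proj₁) (incident _≟_ E w)) cubic))
    (⇔-sym (klein⇔zero-sum E c w)))

-- Nowhere-zero 4-flows and nowhere-zero ℤ₂ × ℤ₂-flows

KleinFlow : Graph → Set
KleinFlow G = Σ[ c ∈ Vector (Fin 3) (nE G) ] (∀ v → KleinAt _≟ᵐ_ (end G) c (just v))

unit-even⇒0 : ∀ i → ∣ i ∣ ≤ 1 → parityℤ i ≡ 0ℙ → i ≡ 0ℤ
unit-even⇒0 (ℤ.+ 0)             _        _  = refl
unit-even⇒0 (ℤ.+ 1)             _        ()
unit-even⇒0 (ℤ.+ suc (suc _))   (s≤s ()) _
unit-even⇒0 -[1+ 0 ]            _        ()
unit-even⇒0 -[1+ suc _ ]        (s≤s ()) _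

∣i+i∣ : ∀ i → ∣ i ℤ.+ i ∣ ≡ ∣ i ∣ ℕ.+ ∣ i ∣
∣i+i∣ (ℤ.+ k)   = refl
∣i+i∣ -[1+ k ]  = cong suc (sym (ℕₚ.+-suc k k))

i+i≡0⇒i≡0 : ∀ i → i ℤ.+ i ≡ 0ℤ → i ≡ 0ℤ
i+i≡0⇒i≡0 (ℤ.+ 0) _ = refl

half-odd : ∀ k → 1 ≤ k ℕ.+ k → k ℕ.+ k ≤ 3 → parity k ≡ 1ℙ
half-odd 1             _ _              = refl
half-odd (suc (suc k)) _ (s≤s (s≤s hi)) =
  contradiction (ℕₚ.≤-trans (ℕₚ.m≤n+m (2 ℕ.+ k) k) hi) λ { (s≤s ()) }

-- Together with the ±1-flow y on its odd part, the flow x is twice a flow g.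
odd-or-half-odd : ∀ x y g → 1 ≤ ∣ x ∣ → ∣ x ∣ ≤ 3 → ∣ y ∣ ≤ 1 → parityℤ y ≡ parityℤ x →
  x ℤ.+ y ≡ g ℤ.+ g → parityℤ x ≡ 1ℙ ⊎ parityℤ g ≡ 1ℙ
odd-or-half-odd x y g lo hi small same halves with parityℤ x
... | 1ℙ = inj₁ refl
... | 0ℙ = inj₂ (half-odd ∣ g ∣ (subst (1 ≤_) ∣x∣ lo) (subst (_≤ 3) ∣x∣ hi))
  where
  open ≡-Reasoning
  ∣x∣ : ∣ x ∣ ≡ ∣ g ∣ ℕ.+ ∣ g ∣
  ∣x∣ = begin
    ∣ x ∣          ≡⟨ cong ∣_∣ (ℤₚ.+-identityʳ x) ⟨
    ∣ x ℤ.+ 0ℤ ∣   ≡⟨ cong (λ i → ∣ x ℤ.+ i ∣) (unit-even⇒0 y small same) ⟨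
    ∣ x ℤ.+ y ∣    ≡⟨ cong ∣_∣ halves ⟩
    ∣ g ℤ.+ g ∣    ≡⟨ ∣i+i∣ g ⟩
    ∣ g ∣ ℕ.+ ∣ g ∣ ∎

∣i+2j∣≤3 : ∀ i j → ∣ i ∣ ≤ 1 → ∣ j ∣ ≤ 1 → ∣ i ℤ.+ (j ℤ.+ j) ∣ ≤ 3
∣i+2j∣≤3 i j i-unit j-unit = begin
  ∣ i ℤ.+ (j ℤ.+ j) ∣             ≤⟨ ℤₚ.∣i+j∣≤∣i∣+∣j∣ i (j ℤ.+ j) ⟩
  ∣ i ∣ ℕ.+ ∣ j ℤ.+ j ∣           ≡⟨ cong (∣ i ∣ ℕ.+_) (∣i+i∣ j) ⟩
  ∣ i ∣ ℕ.+ (∣ j ∣ ℕ.+ ∣ j ∣)     ≤⟨ ℕₚ.+-mono-≤ i-unit (ℕₚ.+-mono-≤ j-unit j-unit) ⟩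
  3                               ∎
  where open ℕₚ.≤-Reasoning

i+2j≡0⇒i≡0×j≡0 : ∀ i j → ∣ i ∣ ≤ 1 → i ℤ.+ (j ℤ.+ j) ≡ 0ℤ → i ≡ 0ℤ × j ≡ 0ℤ
i+2j≡0⇒i≡0×j≡0 i j i-unit sum≡0 = i≡0 , i+i≡0⇒i≡0 j (begin
  j ℤ.+ j             ≡⟨ ℤₚ.+-identityˡ (j ℤ.+ j) ⟨
  0ℤ ℤ.+ (j ℤ.+ j)    ≡⟨ cong (λ k → k ℤ.+ (j ℤ.+ j)) i≡0 ⟨
  i ℤ.+ (j ℤ.+ j)     ≡⟨ sum≡0 ⟩
  0ℤ                  ∎)
  where
  open ≡-Reasoning
  i≡0 : i ≡ 0ℤ
  i≡0 = unit-even⇒0 i i-unit (begin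
    parityℤ i                                      ≡⟨ ℙₚ.+-identityʳ (parityℤ i) ⟨
    parityℤ i ℙ.+ 0ℙ                               ≡⟨ cong (parityℤ i ℙ.+_) (ℙₚ.p+p≡0ℙ (parityℤ j)) ⟨
    parityℤ i ℙ.+ (parityℤ j ℙ.+ parityℤ j)        ≡⟨ cong (parityℤ i ℙ.+_) (parityℤ-+ j j) ⟨
    parityℤ i ℙ.+ parityℤ (j ℤ.+ j)                ≡⟨ parityℤ-+ i (j ℤ.+ j) ⟨
    parityℤ (i ℤ.+ (j ℤ.+ j))                      ≡⟨ cong parityℤ sum≡0 ⟩
    0ℙ                                             ∎)

1≤∣i+2j∣ : ∀ i j → ∣ i ∣ ≤ 1 → parityℤ i ≡ 1ℙ ⊎ parityℤ j ≡ 1ℙ → 1 ≤ ∣ i ℤ.+ (j ℤ.+ j) ∣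
1≤∣i+2j∣ i j i-unit odd = ℕₚ.n≢0⇒n>0 λ ∣sum∣≡0 →
  let i≡0 , j≡0 = i+2j≡0⇒i≡0×j≡0 i j i-unit (ℤₚ.∣i∣≡0⇒i≡0 ∣sum∣≡0)
  in [ odd⇒≢0 i≡0 , odd⇒≢0 j≡0 ]′ odd
  where
  odd⇒≢0 : ∀ {i} → i ≡ 0ℤ → ¬ (parityℤ i ≡ 1ℙ)
  odd⇒≢0 refl ()

module _ (G : Graph) where
  open Boundary ℤₚ.+-*-ring (_≟ᵐ_ {nV G}) using (δ; *-δ)
    renaming (incidence to incidenceℤ; ∂ to ∂ℤ; ∂-+ to ∂ℤ-+; ∂-cong to ∂ℤ-cong;
      IsCycle to IsCycleℤ; cycle-+ to cycleℤ-+)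
  open Boundary ℙₚ.+-*-ring (_≟ᵐ_ {nV G}) using ()
    renaming (∂-cong to ∂ℙ-cong; IsCycle to IsCycleℙ)
  open ≡-Reasoning

  private
    E : Ends (nE G) (Maybe (Fin (nV G)))
    E = end G

  signed : (Fin (nE G) → Bool) → Vector ℤ (nE G) → Vector ℤ (nE G)
  signed o f e = if o e then ℤ.- f e else f e

  ∣signed∣ : ∀ o f e → ∣ signed o f e ∣ ≡ ∣ f e ∣
  ∣signed∣ o f e with o e
  ... | true  = ℤₚ.∣-i∣≡∣i∣ (f e)
  ... | false = refl

  net-inflow : (Fin (nE G) → Bool) → Vector ℤ (nE G) → Maybe (Fin (nV G)) → Vector ℤ (nE G)
  net-inflow o f w e =
    (if ⌊ headE G o e ≟ᵐ w ⌋ then f e else 0ℤ) ℤ.- (if ⌊ tailE G o e ≟ᵐ w ⌋ then f e else 0ℤ)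

  net-inflow≡ : ∀ o f w e → net-inflow o f w e ≡ signed o f e ℤ.* incidenceℤ E w e
  net-inflow≡ o f w e with o e
  ... | true  = trans (sym (cong₂ ℤ._-_ (*-δ (f e) (E e 0F) w) (*-δ (f e) (E e 1F) w)))
                  (reverse (f e) (δ (E e 0F) w) (δ (E e 1F) w))
    where
    reverse : ∀ k s t → k ℤ.* s ℤ.- k ℤ.* t ≡ (ℤ.- k) ℤ.* (t ℤ.- s)
    reverse = solve-∀
  ... | false = trans (sym (cong₂ ℤ._-_ (*-δ (f e) (E e 1F) w) (*-δ (f e) (E e 0F) w)))
                  (factor (f e) (δ (E e 1F) w) (δ (E e 0F) w))
    where
    factor : ∀ k t s → k ℤ.* t ℤ.- k ℤ.* s ≡ k ℤ.* (t ℤ.- s)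
    factor = solve-∀

  kirchhoff≡∂ : ∀ o f v → sumℤ (net-inflow o f (just v)) ≡ ∂ℤ E (signed o f) (just v)
  kirchhoff≡∂ o f v = trans (sumℤ≡sum (net-inflow o f (just v)))
    (∑ℤ.sum-cong-≗ (net-inflow≡ o f (just v)))

  parityℤ-cycle : (x : Vector ℤ (nE G)) → IsCycleℤ E x → IsCycleℙ E (parityℤ ∘ x)
  parityℤ-cycle x x-cycle w = trans
    (sym (∂-homo ℤₚ.+-*-ring ℙₚ.+-*-ring _≟ᵐ_ parityℤ-isRingHomomorphism E x w))
    (cong parityℤ (x-cycle w))

  double-cycle⇒cycle : (g : Vector ℤ (nE G)) → IsCycleℤ E (λ e → g e ℤ.+ g e) → IsCycleℤ E g
  double-cycle⇒cycle g cycle w = i+i≡0⇒i≡0 (∂ℤ E g w) (trans (sym (∂ℤ-+ E g g w)) (cycle w))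

  odd-cover⇒klein : (x g : Vector ℤ (nE G)) → IsCycleℤ E x → IsCycleℤ E g →
    (∀ e → parityℤ (x e) ≡ 1ℙ ⊎ parityℤ (g e) ≡ 1ℙ) → KleinFlow G
  odd-cover⇒klein x g x-cycle g-cycle odd = c , λ v → λ
    { 0F → trans (∂ℙ-cong E (proj₁ ∘ bits) (just v)) (parityℤ-cycle x x-cycle (just v))
    ; 1F → trans (∂ℙ-cong E (proj₂ ∘ bits) (just v)) (parityℤ-cycle g g-cycle (just v)) }
    where
    c : Vector (Fin 3) (nE G)
    c e = colour (parityℤ (x e)) (parityℤ (g e))
    bits : ∀ e → bit 0F (c e) ≡ parityℤ (x e) × bit 1F (c e) ≡ parityℤ (g e)
    bits e = bit-colour (parityℤ (x e)) (parityℤ (g e)) (odd e)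

  module _ (closed : IsGraph G) where

    flow⇒klein : HasNZ4Flow G → KleinFlow G
    flow⇒klein (o , f , bounds , kirchhoff) = odd-cover⇒klein x g x-cycle g-cycle λ e →
        odd-or-half-odd (x e) (y e) (g e)
          (subst (1 ≤_) (sym (∣signed∣ o f e)) (proj₁ (bounds e)))
          (subst (_≤ 3) (sym (∣signed∣ o f e)) (proj₂ (bounds e)))
          (y-unit e) (y-parity e) (proj₂ (halves e))
      where
      x : Vector ℤ (nE G)
      x = signed o f
      x-cycle : IsCycleℤ E x
      x-cycle = closed-cycle ℤₚ.+-*-ring E closed x λ v → trans (sym (kirchhoff≡∂ o f v)) (kirchhoff v)
      open UnitLift (lift-cycle _≟ᵐ_ E (parityℤ ∘ x) (parityℤ-cycle x x-cycle))
        renaming (chain to y; unit to y-unit; lifts to y-parity; boundary to y-cycle)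
      halves : ∀ e → ∃ λ g → x e ℤ.+ y e ≡ g ℤ.+ g
      halves e = even⇒double (x e ℤ.+ y e) (begin
        parityℤ (x e ℤ.+ y e)               ≡⟨ parityℤ-+ (x e) (y e) ⟩
        parityℤ (x e) ℙ.+ parityℤ (y e)     ≡⟨ cong (parityℤ (x e) ℙ.+_) (y-parity e) ⟩
        parityℤ (x e) ℙ.+ parityℤ (x e)     ≡⟨ ℙₚ.p+p≡0ℙ (parityℤ (x e)) ⟩
        0ℙ                                  ∎)
      g : Vector ℤ (nE G)
      g = proj₁ ∘ halves
      g-cycle : IsCycleℤ E g
      g-cycle = double-cycle⇒cycle g λ w →
        trans (sym (∂ℤ-cong E (proj₂ ∘ halves) w)) (cycleℤ-+ E x y x-cycle y-cycle w)

    klein⇒flow : KleinFlow G → HasNZ4Flow G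
    klein⇒flow (c , klein) = const false , z , bounds , λ v →
        trans (kirchhoff≡∂ (const false) z v) (z-cycle (just v))
      where
      bit-lift : ∀ b → UnitLift _≟ᵐ_ E (bit b ∘ c) (const 0ℤ)
      bit-lift b = lift-cycle _≟ᵐ_ E (bit b ∘ c)
        (closed-cycle ℙₚ.+-*-ring E closed (bit b ∘ c) λ v → klein v b)
      open UnitLift (bit-lift 0F)
        renaming (chain to x; unit to x-unit; lifts to x-lifts; boundary to x-cycle)
      open UnitLift (bit-lift 1F)
        renaming (chain to y; unit to y-unit; lifts to y-lifts; boundary to y-cycle)
      z : Vector ℤ (nE G)
      z e = x e ℤ.+ (y e ℤ.+ y e)
      z-cycle : IsCycleℤ E z
      z-cycle = cycleℤ-+ E x (λ e → y e ℤ.+ y e) x-cycle (cycleℤ-+ E y y y-cycle y-cycle)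
      bounds : ∀ e → 1 ≤ ∣ z e ∣ × ∣ z e ∣ ≤ 3
      bounds e = 1≤∣i+2j∣ (x e) (y e) (x-unit e)
          (Sum.map (trans (x-lifts e)) (trans (y-lifts e)) (colour-nonzero (c e))) ,
        ∣i+2j∣≤3 (x e) (y e) (x-unit e) (y-unit e)

    flow⇔klein : HasNZ4Flow G ⇔ KleinFlow G
    flow⇔klein = mk⇔ flow⇒klein klein⇒flow

cubic⇒three-incident : ∀ G → Cubic G → ∀ v → length (incident _≟ᵐ_ (end G) (just v)) ≡ 3
cubic⇒three-incident G (_ , deg≡3) v = trans (sym (deg≡length-incident G v)) (deg≡3 v)

-- Deleting and identifying two vertices

delEnd⁻ : (u : Fin (suc n)) (x : Maybe (Fin (suc n))) {w : Fin n} →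
  delEnd u x ≡ just w → x ≡ just (punchIn u w)
delEnd⁻ u (just x) eq with x ≟ᶠ u
... | no x≢u = cong just
  (trans (sym (punchIn-punchOut (x≢u ∘ sym))) (cong (punchIn u) (just-injective eq)))

delEnd-punchIn : (u : Fin (suc n)) (w : Fin n) → delEnd u (just (punchIn u w)) ≡ just w
delEnd-punchIn u w with punchIn u w ≟ᶠ u
... | yes eq = contradiction eq (punchInᵢ≢i u w)
... | no _   = cong just (trans (punchOut-cong u refl) (punchOut-punchIn u))

module TwoDeleted {k : ℕ} (u v : Fin (suc (suc k))) (u≢v : u ≢ v) where

  delete : Maybe (Fin (suc (suc k))) → Maybe (Fin k)
  delete x = delEnd (punchOut u≢v) (delEnd u x)

  embed : Fin k → Fin (suc (suc k))
  embed w = punchIn u (punchIn (punchOut u≢v) w)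

  delete⁻ : ∀ x {w} → delete x ≡ just w → x ≡ just (embed w)
  delete⁻ x eq = delEnd⁻ u x (delEnd⁻ (punchOut u≢v) (delEnd u x) eq)

  delete-embed : ∀ w → delete (just (embed w)) ≡ just w
  delete-embed w = trans (cong (delEnd (punchOut u≢v)) (delEnd-punchIn u (punchIn (punchOut u≢v) w)))
    (delEnd-punchIn (punchOut u≢v) w)

  delete⇔embed : ∀ x w → delete x ≡ just w ⇔ x ≡ just (embed w)
  delete⇔embed x w = mk⇔ (delete⁻ x) λ x≡w → trans (cong delete x≡w) (delete-embed w)

  embed≢u : ∀ w → embed w ≢ u
  embed≢u w = punchInᵢ≢i u (punchIn (punchOut u≢v) w)

  embed≢v : ∀ w → embed w ≢ v
  embed≢v w eq = punchInᵢ≢i (punchOut u≢v) w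
    (punchIn-injective u _ _ (trans eq (sym (punchIn-punchOut u≢v))))

  embed-onto : ∀ w → w ≢ u → w ≢ v → ∃ λ w′ → embed w′ ≡ w
  embed-onto w w≢u w≢v =
    punchOut v′≢w′ , trans (cong (punchIn u) (punchIn-punchOut v′≢w′)) (punchIn-punchOut (w≢u ∘ sym))
    where
    v′≢w′ : punchOut u≢v ≢ punchOut (w≢u ∘ sym)
    v′≢w′ eq = w≢v (sym (punchOut-injective u≢v (w≢u ∘ sym) eq))

ColourableOff : (G : Graph) (u v : Fin (nV G)) → Set
ColourableOff G u v = Σ[ c ∈ Vector (Fin 3) (nE G) ] (∀ w → w ≢ u → w ≢ v → ProperAt (end G) c (just w))

remove2⇔off : ∀ G u v (u≢v : u ≢ v) → Colourable (remove2 G u v u≢v) ⇔ ColourableOff G u v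
remove2⇔off (mkGraph (suc zero)    m E) 0F 0F u≢v = contradiction refl u≢v
remove2⇔off (mkGraph (suc (suc k)) m E) u  v  u≢v = mk⇔
    (λ (c , proper) → c , λ w w≢u w≢v e i e′ i′ ne p q →
      let w′ , embed-w′ = embed-onto w w≢u w≢v
      in proper w′ e i e′ i′ ne (attach p embed-w′) (attach q embed-w′))
    (λ (c , proper) → c , λ w e i e′ i′ ne p q →
      proper (embed w) (embed≢u w) (embed≢v w) e i e′ i′ ne (delete⁻ (E e i) p) (delete⁻ (E e′ i′) q))
  where
  open TwoDeleted u v u≢v
  attach : ∀ {x w w′} → x ≡ just w → embed w′ ≡ w → delete x ≡ just w′
  attach {x} {w′ = w′} p embed-w′ =
    Equivalence.from (delete⇔embed x w′) (trans p (cong just (sym embed-w′)))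

module _ {k : ℕ} (u v : Fin (suc k)) (u≢v : u ≢ v) where
  private
    merge : Fin (suc k) → Fin k
    merge = mergeV u v u≢v

  merge-≢v : ∀ w (w≢v : w ≢ v) → merge w ≡ punchOut (w≢v ∘ sym)
  merge-≢v w w≢v with w ≟ᶠ v
  ... | yes w≡v = contradiction w≡v w≢v
  ... | no _    = punchOut-cong v refl

  merge-injective-off : ∀ x w → w ≢ u → w ≢ v → merge x ≡ merge w → x ≡ w
  merge-injective-off x w w≢u w≢v eq with x ≟ᶠ v
  ... | yes _  = contradiction
    (sym (punchOut-injective (u≢v ∘ sym) (w≢v ∘ sym) (trans eq (merge-≢v w w≢v)))) w≢u
  ... | no x≢v = punchOut-injective (x≢v ∘ sym) (w≢v ∘ sym) (trans eq (merge-≢v w w≢v))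

  merge-onto-off : ∀ w′ → w′ ≢ merge u → ∃ λ w → w ≢ u × w ≢ v × merge w ≡ w′
  merge-onto-off w′ w′≢u =
    punchIn v w′ , (λ eq → w′≢u (trans (sym merged) (cong merge eq))) , punchInᵢ≢i v w′ , merged
    where
    merged : merge (punchIn v w′) ≡ w′
    merged = trans (merge-≢v (punchIn v w′) (punchInᵢ≢i v w′)) (punchOut-punchIn v)

  map-merge⇔ : ∀ x w → w ≢ u → w ≢ v → x ≡ just w ⇔ map merge x ≡ just (merge w)
  map-merge⇔ x w w≢u w≢v = mk⇔ (cong (map merge)) (reflects x)
    where
    reflects : ∀ x → map merge x ≡ just (merge w) → x ≡ just w
    reflects (just x) eq = cong just (merge-injective-off x w w≢u w≢v (just-injective eq))

identify-closed : ∀ G u v (u≢v : u ≢ v) → IsGraph G → IsGraph (identify G u v u≢v)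
identify-closed (mkGraph (suc k) m E) u v u≢v closed e i with w , eq ← closed e i =
  mergeV u v u≢v w , cong (map (mergeV u v u≢v)) eq

off⇔klein : ∀ G → Cubic G → ∀ u v (u≢v : u ≢ v) →
  ColourableOff G u v ⇔ KleinFlow (identify G u v u≢v)
off⇔klein G@(mkGraph (suc k) m E) cubic@(closed , _) u v u≢v = mk⇔
  (λ (c , proper) → c , λ w′ b → everywhere c proper b w′)
  (λ (c , klein) → c , λ w w≢u w≢v → Equivalence.from (proper⇔klein-at c w)
    λ b → trans (∂-merge w w≢u w≢v (bit b ∘ c)) (klein (merge w) b))
  where
  open Boundary ℙₚ.+-*-ring using (∂)
  merge : Fin (suc k) → Fin k
  merge = mergeV u v u≢v
  E′ : Ends m (Maybe (Fin k))
  E′ e i = map merge (E e i)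
  proper⇔klein-at : ∀ c w → ProperAt E c (just w) ⇔ KleinAt _≟ᵐ_ E c (just w)
  proper⇔klein-at c w = proper⇔klein _≟ᵐ_ E c (just w) (cubic⇒three-incident G cubic w)
  ∂-merge : ∀ w → w ≢ u → w ≢ v → ∀ p → ∂ _≟ᵐ_ E p (just w) ≡ ∂ _≟ᵐ_ E′ p (just (merge w))
  ∂-merge w w≢u w≢v = ∂ℙ-cong-ends _≟ᵐ_ _≟ᵐ_ E E′ λ e i → map-merge⇔ u v u≢v (E e i) w w≢u w≢v
  module _ (c : Vector (Fin 3) m) (proper : ∀ w → w ≢ u → w ≢ v → ProperAt E c (just w))
    (b : Fin 2) where
    elsewhere : ∀ w′ → w′ ≢ merge u → ∂ _≟ᵐ_ E′ (bit b ∘ c) (just w′) ≡ 0ℙ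
    elsewhere w′ w′≢u with w , w≢u , w≢v , refl ← merge-onto-off u v u≢v w′ w′≢u =
      trans (sym (∂-merge w w≢u w≢v (bit b ∘ c)))
        (Equivalence.to (proper⇔klein-at c w) (proper w w≢u w≢v) b)
    everywhere : ∀ w′ → ∂ _≟ᵐ_ E′ (bit b ∘ c) (just w′) ≡ 0ℙ
    everywhere w′ with w′ ≟ᶠ merge u
    ... | no w′≢u  = elsewhere w′ w′≢u
    ... | yes refl = ∂-zero-elsewhere⇒zero ℙₚ.+-*-ring E′ (identify-closed G u v u≢v closed)
      (bit b ∘ c) (merge u) elsewhere

remove2-colourable⇔identify-flow : ∀ G → Cubic G → ∀ u v (u≢v : u ≢ v) →
  Colourable (remove2 G u v u≢v) ⇔ HasNZ4Flow (identify G u v u≢v)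
remove2-colourable⇔identify-flow G cubic@(closed , _) u v u≢v = ⇔-trans (remove2⇔off G u v u≢v)
  (⇔-trans (off⇔klein G cubic u v u≢v)
    (⇔-sym (flow⇔klein (identify G u v u≢v) (identify-closed G u v u≢v closed))))

bicritical⇔fourVertexCritical : ∀ G → Cubic G → Bicritical G ⇔ FourVertexCritical G
bicritical⇔fourVertexCritical G cubic = mk⇔
  (λ bicritical u v u≢v → Equivalence.to (colourable⇔flow u v u≢v) (bicritical u v u≢v))
  (λ critical u v u≢v → Equivalence.from (colourable⇔flow u v u≢v) (critical u v u≢v))
  where
  colourable⇔flow : ∀ u v (u≢v : u ≢ v) →
    Colourable (remove2 G u v u≢v) ⇔ HasNZ4Flow (identify G u v u≢v)
  colourable⇔flow = remove2-colourable⇔identify-flow G cubic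

-- Dangling edges

just? : (x : Maybe A) → Dec (∃ λ a → x ≡ just a)
just? (just a) = yes (a , refl)
just? nothing  = no λ ()

¬just⇒nothing : {x : Maybe A} → ¬ (∃ λ a → x ≡ just a) → x ≡ nothing
¬just⇒nothing {x = just a}  free = contradiction (a , refl) free
¬just⇒nothing {x = nothing} free = refl

attached? : (E : Ends m (Maybe A)) → ∀ e → Dec (Attached E e)
attached? E e = map′ (λ (p , q) → λ { 0F → p ; 1F → q }) (λ attached → attached 0F , attached 1F)
  (just? (E e 0F) ×-dec just? (E e 1F))

¬attached⇒detached : (E : Ends m (Maybe A)) → ∀ {e} → ¬ Attached E e → ∃ λ i → E e i ≡ nothing
¬attached⇒detached E {e} ¬attached with just? (E e 0F) | just? (E e 1F)
... | no free     | _           = 0F , ¬just⇒nothing free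
... | yes _       | no free     = 1F , ¬just⇒nothing free
... | yes p       | yes q       = contradiction (λ { 0F → p ; 1F → q }) ¬attached

attachedEdges : Ends m (Maybe A) → List (Fin m)
attachedEdges {m} E = filter (attached? E) (allFin m)

stub : (Fin 2 → Maybe A) → Maybe A
stub ends with ends 0F | ends 1F
... | just a  | nothing = just a
... | nothing | just b  = just b
... | _       | _       = nothing

stubs : Ends m (Maybe A) → List A
stubs {m} E = mapMaybe (stub ∘ E) (allFin m)

module _ where
  open ∑ℕ
  open Summation ℕₚ.+-0-monoid
  open ≡-Reasoning

  edgeSum : (A → ℕ) → (Fin 2 → Maybe A) → ℕ
  edgeSum f ends = sum λ i → maybe′ f 0 (ends i)

  endSum : (A → ℕ) → Ends m (Maybe A) → ℕ
  endSum f E = sum (edgeSum f ∘ E)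

  ∑ˡ-stubs : (f : A → ℕ) (E : Ends m (Maybe A)) →
    ∑ˡ f (stubs E) ≡ sum λ e → maybe′ f 0 (stub (E e))
  ∑ˡ-stubs {m = m} f E = trans (∑ˡ-mapMaybe f (stub ∘ E) (allFin m))
    (∑ˡ-tabulate (λ e → maybe′ f 0 (stub (E e))) id)

  endSum-split : (f : A → ℕ) (E : Ends m (Maybe A)) →
    endSum f E ≡ ∑ˡ (edgeSum f ∘ E) (attachedEdges E) ℕ.+ ∑ˡ f (stubs E)
  endSum-split {m = m} f E = begin
    endSum f E
      ≡⟨ sum-cong-≗ split ⟩
    sum (λ e → attachedPart e ℕ.+ stubPart e)
      ≡⟨ ∑-distrib-+ attachedPart stubPart ⟩
    sum attachedPart ℕ.+ sum stubPart
      ≡⟨ cong₂ ℕ._+_ (∑ˡ-tabulate attachedPart id) (∑ˡ-stubs f E) ⟨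
    ∑ˡ attachedPart (allFin m) ℕ.+ ∑ˡ f (stubs E)
      ≡⟨ cong (ℕ._+ ∑ˡ f (stubs E)) (∑ˡ-filter (attached? E) (edgeSum f ∘ E) (allFin m)) ⟨
    ∑ˡ (edgeSum f ∘ E) (attachedEdges E) ℕ.+ ∑ˡ f (stubs E) ∎
    where
    attachedPart stubPart : Vector ℕ m
    attachedPart e = if ⌊ attached? E e ⌋ then edgeSum f (E e) else 0
    stubPart e = maybe′ f 0 (stub (E e))
    split : ∀ e → edgeSum f (E e) ≡ attachedPart e ℕ.+ stubPart e
    split e with just? (E e 0F) | just? (E e 1F)
    ... | yes (a , p) | yes (b , q) rewrite p | q = sym (ℕₚ.+-identityʳ _)
    ... | yes (a , p) | no free     rewrite p | ¬just⇒nothing free = ℕₚ.+-identityʳ (f a)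
    ... | no free     | yes (b , q) rewrite ¬just⇒nothing free | q = ℕₚ.+-identityʳ (f b)
    ... | no free     | no free′    rewrite ¬just⇒nothing free | ¬just⇒nothing free′ = refl

  endSum-parity : (E : Ends m (Maybe A)) → parity (endSum (const 1) E) ≡ parity (length (stubs E))
  endSum-parity E = begin
    parity (endSum (const 1) E)                             ≡⟨ parity-sum-cong at-edge ⟩
    parity (sum λ e → maybe′ (const 1) 0 (stub (E e)))      ≡⟨ cong parity (∑ˡ-stubs (const 1) E) ⟨
    parity (∑ˡ (const 1) (stubs E))                         ≡⟨ cong parity (length≡∑ˡ (stubs E)) ⟨
    parity (length (stubs E))                               ∎
    where
    at-edge : ∀ e → parity (edgeSum (const 1) (E e)) ≡ parity (maybe′ (const 1) 0 (stub (E e)))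
    at-edge e with E e 0F | E e 1F
    ... | just _  | just _  = refl
    ... | just _  | nothing = refl
    ... | nothing | just _  = refl
    ... | nothing | nothing = refl

  open Indicator ℕₚ.+-*-semiring using (δ)

  indicator : Fin n → Fin n → ℕ
  indicator v w = δ _≟ᵐ_ (just w) (just v)

  δ≡indicator : (x : Maybe (Fin n)) (v : Fin n) → δ _≟ᵐ_ x (just v) ≡ maybe′ (indicator v) 0 x
  δ≡indicator (just w) v = refl
  δ≡indicator nothing  v = refl

  deg≡endSum : ∀ G v → deg G v ≡ endSum (indicator v) (end G)
  deg≡endSum G v = trans (deg≡sum-δ G v) (sum-cong-≗ λ e → sum-cong-≗ λ i → δ≡indicator (end G e i) v)

  sum-deg : ∀ G → sum (deg G) ≡ endSum (const 1) (end G)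
  sum-deg G = begin
    sum (deg G)
      ≡⟨ sum-cong-≗ (deg≡endSum G) ⟩
    sum (λ v → sum λ e → sum λ i → maybe′ (indicator v) 0 (end G e i))
      ≡⟨ ∑-comm (λ v e → edgeSum (indicator v) (end G e)) ⟩
    sum (λ e → sum λ v → sum λ i → maybe′ (indicator v) 0 (end G e i))
      ≡⟨ sum-cong-≗ (λ e → ∑-comm λ v i → maybe′ (indicator v) 0 (end G e i)) ⟩
    sum (λ e → sum λ i → sum λ v → maybe′ (indicator v) 0 (end G e i))
      ≡⟨ sum-cong-≗ (λ e → sum-cong-≗ λ i → at-end (end G e i)) ⟩
    endSum (const 1) (end G) ∎
    where
    at-end : ∀ x → sum (λ v → maybe′ (indicator v) 0 x) ≡ maybe′ (const 1) 0 x
    at-end (just w) = sum-δ ℕₚ.+-*-semiring w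
    at-end nothing  = sum-replicate-zero (nV G)

  parity-sum-three : ∀ n → parity (sum {n} (const 3)) ≡ parity n
  parity-sum-three n =
    trans (parity-sum-cong {n} {const 3} {const 1} λ _ → refl) (cong parity (sum-one n))
    where
    sum-one : ∀ n → sum {n} (const 1) ≡ n
    sum-one zero    = refl
    sum-one (suc n) = cong suc (sum-one n)

  stubs-parity : ∀ G → (∀ v → deg G v ≡ 3) → parity (length (stubs (end G))) ≡ parity (nV G)
  stubs-parity G deg≡3 = begin
    parity (length (stubs (end G)))          ≡⟨ endSum-parity (end G) ⟨
    parity (endSum (const 1) (end G))        ≡⟨ cong parity (sum-deg G) ⟨
    parity (sum (deg G))                     ≡⟨ cong parity (sum-cong-≗ deg≡3) ⟩
    parity (sum {nV G} (const 3))            ≡⟨ parity-sum-three (nV G) ⟩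
    parity (nV G)                            ∎

closed⇒stubs≡[] : (E : Ends m (Maybe A)) → (∀ e → Attached E e) → stubs E ≡ []
closed⇒stubs≡[] {m} E closed = trans (mapMaybe-cong no-stub (allFin m)) (mapMaybe-nothing (allFin m))
  where
  no-stub : ∀ e → stub (E e) ≡ nothing
  no-stub e with a , p ← closed e 0F | b , q ← closed e 1F rewrite p | q = refl

cubic⇒even : ∀ G → Cubic G → parity (nV G) ≡ 0ℙ
cubic⇒even G (closed , deg≡3) =
  trans (sym (stubs-parity G deg≡3)) (cong (parity ∘ length) (closed⇒stubs≡[] (end G) closed))

-- Completing a multipole to a cubic graph

pairUp : List A → List (A × A)
pairUp (a ∷ b ∷ xs) = (a , b) ∷ pairUp xs
pairUp _            = []

pairEnds : A × A → Fin 2 → Maybe A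
pairEnds (a , b) 0F = just a
pairEnds (a , b) 1F = just b

joinedSize : Ends m (Maybe A) → ℕ
joinedSize E = length (attachedEdges E) ℕ.+ length (pairUp (stubs E))

joinStubs : (E : Ends m (Maybe A)) → Ends (joinedSize E) (Maybe A)
joinStubs E = (E ∘ lookup (attachedEdges E)) Vector.++ (pairEnds ∘ lookup (pairUp (stubs E)))

joinStubs-closed : (E : Ends m (Maybe A)) → ∀ e → Attached (joinStubs E) e
joinStubs-closed {m} E e with splitAt (length (attachedEdges E)) e
... | inj₁ i = proj₂ (∈-filter⁻ (attached? E) {xs = allFin m} (∈-lookup i))
... | inj₂ j = λ { 0F → _ , refl ; 1F → _ , refl }

module _ (E : Ends m (Maybe A)) {e : Fin m} (attached : Attached E e) where
  private
    e∈ : e ∈ attachedEdges E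
    e∈ = ∈-filter⁺ (attached? E) (∈-allFin e) attached

  place : Fin (joinedSize E)
  place = Any.index e∈ ↑ˡ length (pairUp (stubs E))

  joinStubs-place : joinStubs E place ≡ E e
  joinStubs-place = trans (lookup-++ˡ (E ∘ lookup (attachedEdges E)) _ (Any.index e∈))
    (cong E (sym (Any.lookup-index e∈)))

place-injective : (E : Ends m (Maybe A)) → ∀ {e e′}
  (attached : Attached E e) (attached′ : Attached E e′) →
  place E attached ≡ place E attached′ → e ≡ e′
place-injective E attached attached′ same = index-injective (≡-setoid _)
  (∈-filter⁺ (attached? E) (∈-allFin _) attached) (∈-filter⁺ (attached? E) (∈-allFin _) attached′)
  (↑ˡ-injective (length (pairUp (stubs E))) _ _ same)

module _ where
  open ∑ℕ
  open Summation ℕₚ.+-0-monoid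
  open ≡-Reasoning

  ∑ˡ-pairUp : (f : A → ℕ) (xs : List A) → parity (length xs) ≡ 0ℙ →
    ∑ˡ (edgeSum f ∘ pairEnds) (pairUp xs) ≡ ∑ˡ f xs
  ∑ˡ-pairUp f []           even = refl
  ∑ˡ-pairUp f (a ∷ b ∷ xs) even = begin
    f a ℕ.+ (f b ℕ.+ 0) ℕ.+ ∑ˡ (edgeSum f ∘ pairEnds) (pairUp xs)
      ≡⟨ cong₂ (λ k l → f a ℕ.+ k ℕ.+ l) (ℕₚ.+-identityʳ (f b)) (∑ˡ-pairUp f xs even) ⟩
    f a ℕ.+ f b ℕ.+ ∑ˡ f xs      ≡⟨ ℕₚ.+-assoc (f a) (f b) _ ⟩
    f a ℕ.+ (f b ℕ.+ ∑ˡ f xs)    ∎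

  endSum-joinStubs : {A : Set ℓᵃ} (f : A → ℕ) (E : Ends m (Maybe A)) → parity (length (stubs E)) ≡ 0ℙ →
    endSum f (joinStubs E) ≡ endSum f E
  endSum-joinStubs {m = m} {A = A} f E even = begin
    endSum f (joinStubs E)
      ≡⟨ sum-++ (edgeSum f) (E ∘ lookup kept) (pairEnds ∘ lookup pairs) ⟩
    sum (edgeSum f ∘ E ∘ lookup kept) ℕ.+ sum (edgeSum f ∘ pairEnds ∘ lookup pairs)
      ≡⟨ cong₂ ℕ._+_ (sum-lookup (edgeSum f ∘ E) kept) (sum-lookup (edgeSum f ∘ pairEnds) pairs) ⟩
    ∑ˡ (edgeSum f ∘ E) kept ℕ.+ ∑ˡ (edgeSum f ∘ pairEnds) pairs
      ≡⟨ cong (∑ˡ (edgeSum f ∘ E) kept ℕ.+_) (∑ˡ-pairUp f (stubs E) even) ⟩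
    ∑ˡ (edgeSum f ∘ E) kept ℕ.+ ∑ˡ f (stubs E)
      ≡⟨ endSum-split f E ⟨
    endSum f E ∎
    where
    kept : List (Fin m)
    kept = attachedEdges E
    pairs : List (A × A)
    pairs = pairUp (stubs E)

completion : Graph → Graph
completion G = mkGraph (nV G) (joinedSize (end G)) (joinStubs (end G))

completion-cubic : ∀ G → parity (nV G) ≡ 0ℙ → (∀ v → deg G v ≡ 3) → Cubic (completion G)
completion-cubic G even deg≡3 = joinStubs-closed (end G) , λ v → begin
  deg (completion G) v                        ≡⟨ deg≡endSum (completion G) v ⟩
  endSum (indicator v) (joinStubs (end G))    ≡⟨ endSum-joinStubs (indicator v) (end G) even-stubs ⟩
  endSum (indicator v) (end G)                ≡⟨ deg≡endSum G v ⟨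
  deg G v                                     ≡⟨ deg≡3 v ⟩
  3                                           ∎
  where
  open ≡-Reasoning
  even-stubs : parity (length (stubs (end G))) ≡ 0ℙ
  even-stubs = trans (stubs-parity G deg≡3) even

-- Bicritical cubic graphs are irreducible

InjectiveOn : (Fin n → Bool) → (Fin n → Fin m) → Set
InjectiveOn S φ = ∀ u v → S u ≡ true → S v ≡ true → φ u ≡ φ v → u ≡ v

vertex-outside : (S : Fin n → Bool) (φ : Fin n → Fin m) → InjectiveOn S φ → m < n → ∃ λ u → S u ≡ false
vertex-outside S φ φ-inj m<n with any? (λ u → S u ≟ᵇ false)
... | yes found = found
... | no none   = contradiction (injective⇒≤ λ {u} {v} → φ-inj u v (inside u) (inside v)) (ℕₚ.<⇒≱ m<n)
  where
  inside : ∀ u → S u ≡ true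
  inside u = ¬-not λ outside → none (u , outside)

two-vertices-outside : (S : Fin n → Bool) (φ : Fin n → Fin m) → InjectiveOn S φ → suc m < n →
  ∃ λ u → ∃ λ v → u ≢ v × S u ≡ false × S v ≡ false
two-vertices-outside {suc n} S φ φ-inj (s≤s m<n)
  with u , Su ← vertex-outside S φ φ-inj (ℕₚ.m≤n⇒m≤1+n m<n)
  with v , Sv ← vertex-outside (S ∘ punchIn u) (φ ∘ punchIn u)
         (λ x y Sx Sy eq → punchIn-injective u x y (φ-inj (punchIn u x) (punchIn u y) Sx Sy eq)) m<n
  = u , punchIn u v , punchInᵢ≢i u v ∘ sym , Su , Sv

even<even⇒suc< : parity m ≡ 0ℙ → parity n ≡ 0ℙ → m < n → suc m < n
even<even⇒suc< {m} m-even n-even m<n = ℕₚ.≤∧≢⇒< m<n λ { refl →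
  contradiction (trans (cong _⁻¹ (sym n-even)) (trans (ℙₚ.suc-homo-⁻¹ m) m-even)) λ () }

bicritical⇒kIrreducible : ∀ G → Cubic G → Bicritical G → ∀ k → KIrreducible k G
bicritical⇒kIrreducible G cubic bicritical k F _ S _ uncolourable
  (H , H-cubic , H<G , φ , _ , φ-inj , _)
  with u , v , u≢v , Su , Sv ← two-vertices-outside S φ φ-inj
         (even<even⇒suc< (cubic⇒even H H-cubic) (cubic⇒even G cubic) H<G)
  with c , proper ← Equivalence.to (remove2⇔off G u v u≢v) (bicritical u v u≢v)
  = uncolourable ((λ e _ → c e) , (λ _ _ → refl) ,
      λ w Sw → proper w (separated Sw Su) (separated Sw Sv))
  where
  separated : ∀ {w x} → S w ≡ true → S x ≡ false → w ≢ x
  separated Sw Sx refl = contradiction (trans (sym Sw) Sx) λ ()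

-- Connected components

Linked : {A : Set ℓᵃ} → List (A × A) → A → A → Set ℓᵃ
Linked links x y = (x , y) ∈ links

module _ {ℓ} {A : Set ℓ} (_≟_ : DecidableEquality A) where

  redirect : A → A → A → A
  redirect from to x = if does (x ≟ from) then to else x

  -- Adding a link from a to b gives the class of b the label of the class of a.
  classify-links : (links : List (A × A)) →
    ∃ λ (r : A → A) → ∀ x y → r x ≡ r y ⇔ EqClosure (Linked links) x y
  classify-links [] = id , λ x y → mk⇔ (λ { refl → Star.ε }) (EqClosure.fold ≡-isEquivalence λ ())
  classify-links ((a , b) ∷ links) with r , r-classes ← classify-links links = r′ , λ x y →
      mk⇔ (complete x y) (EqClosure.gfold ≡-isEquivalence r′ sound)
    where
    r′ : A → A
    r′ = redirect (r b) (r a) ∘ r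
    redirected-a : r′ a ≡ r a
    redirected-a with r a ≟ r b
    ... | yes _ = refl
    ... | no _  = refl
    redirected-b : r′ b ≡ r a
    redirected-b with r b ≟ r b
    ... | yes _  = refl
    ... | no b≢b = contradiction refl b≢b
    sound : ∀ {x y} → Linked ((a , b) ∷ links) x y → r′ x ≡ r′ y
    sound (here refl)    = trans redirected-a (sym redirected-b)
    sound (there linked) = cong (redirect (r b) (r a))
      (Equivalence.from (r-classes _ _) (EqClosure.return linked))
    earlier : ∀ {x y} → r x ≡ r y → EqClosure (Linked ((a , b) ∷ links)) x y
    earlier same = EqClosure.map there (Equivalence.to (r-classes _ _) same)
    new-link : EqClosure (Linked ((a , b) ∷ links)) a b
    new-link = EqClosure.return (here refl)
    complete : ∀ x y → r′ x ≡ r′ y → EqClosure (Linked ((a , b) ∷ links)) x y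
    complete x y same with r x ≟ r b | r y ≟ r b
    ... | yes x~b | yes y~b = earlier (trans x~b (sym y~b))
    ... | yes x~b | no _    = earlier x~b ◅◅ EqClosure.symmetric _ new-link ◅◅ earlier same
    ... | no _    | yes y~b = earlier same ◅◅ new-link ◅◅ earlier (sym y~b)
    ... | no _    | no _    = earlier same

classify : {R : Fin n → Fin n → Set} → Symmetric R → (∀ x y → Dec (R x y)) →
  ∃ λ (r : Fin n → Fin n) → ∀ x y → r x ≡ r y ⇔ Star R x y
classify {n} {R} R-sym R? = r , λ x y → ⇔-trans (r-classes x y) (mk⇔
    (Star.map (SymClosure.fold R-sym (proj₂ ∘ ∈-filter⁻ related? {xs = pairs})))
    (Star.map (fwd ∘ ∈-filter⁺ related? (∈-cartesianProduct⁺ (∈-allFin _) (∈-allFin _)))))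
  where
  pairs : List (Fin n × Fin n)
  pairs = cartesianProduct (allFin n) (allFin n)
  related? : ∀ xy → Dec (R (proj₁ xy) (proj₂ xy))
  related? (x , y) = R? x y
  open Σ (classify-links _≟ᶠ_ (filter related? pairs)) renaming (proj₁ to r; proj₂ to r-classes)

adj-sym : ∀ G → Symmetric (Adj G)
adj-sym G (e , ends) = e , Sum.swap ends

adj? : ∀ G u v → Dec (Adj G u v)
adj? G u v = any? λ e → ((end G e 0F ≟ᵐ just u) ×-dec (end G e 1F ≟ᵐ just v))
                   ⊎-dec ((end G e 0F ≟ᵐ just v) ×-dec (end G e 1F ≟ᵐ just u))

components : ∀ G → ∃ λ (r : Fin (nV G) → Fin (nV G)) → ∀ u v → r u ≡ r v ⇔ Star (Adj G) u v
components G = classify (adj-sym G) (adj? G)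

-- Decidability of colourability

any-function? : ∀ {k} {P : (Fin m → Fin k) → Set} → (∀ {f g} → (∀ i → f i ≡ g i) → P f → P g) →
  (∀ f → Dec (P f)) → Dec (∃ P)
any-function? resp P? = map′ (λ (i , p) → finToFun i , p)
  (λ (f , p) → funToFin f , resp (λ i → sym (finToFun-funToFin f i)) p) (any? λ i → P? (finToFun i))

colourable? : ∀ G → Dec (Colourable G)
colourable? G = any-function?
  (λ c≗c′ proper v e i e′ i′ ne p q same →
    proper v e i e′ i′ ne p q (trans (c≗c′ e) (trans same (sym (c≗c′ e′)))))
  (λ c → all? λ v → all? λ e → all? λ i → all? λ e′ → all? λ i′ →
    ¬? (×-≡-dec _≟ᶠ_ _≟ᶠ_ (e , i) (e′ , i′)) →-dec ((end G e i ≟ᵐ just v) →-dec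
      ((end G e′ i′ ≟ᵐ just v) →-dec ¬? (c e ≟ᶠ c e′))))

-- Colourings of half-edges

HalfEdgeColourable : (G : Graph) → (Fin (nV G) → Set) → Set
HalfEdgeColourable G P = Σ[ c ∈ Ends (nE G) (Fin 3) ]
  (∀ e → Attached (end G) e → c e 0F ≡ c e 1F) ×
  (∀ w → P w → ∀ e i e′ i′ → (e , i) ≢ (e′ , i′) →
    end G e i ≡ just w → end G e′ i′ ≡ just w → c e i ≢ c e′ i′)

halfEdgeColourable⇒colourable : ∀ G → HalfEdgeColourable G (λ _ → ⊤) → Colourable G
halfEdgeColourable⇒colourable G (c , consistent , proper) = colour-of , λ w e i e′ i′ ne p q same →
    proper w tt e i e′ i′ ne p q (trans (sym (colour-of-end p)) (trans same (colour-of-end q)))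
  where
  colour-of : Vector (Fin 3) (nE G)
  colour-of e = if does (just? (end G e 0F)) then c e 0F else c e 1F
  colour-of-end : ∀ {e i w} → end G e i ≡ just w → colour-of e ≡ c e i
  colour-of-end {e} {i} p with just? (end G e 0F)
  colour-of-end {e} {0F} p | yes _  = refl
  colour-of-end {e} {1F} p | yes q  = consistent e λ { 0F → q ; 1F → _ , p }
  colour-of-end {e} {0F} p | no free = contradiction (_ , p) free
  colour-of-end {e} {1F} p | no _   = refl

glue-colourings : ∀ G (r : Fin (nV G) → Fin n) → (∀ {a b} → Adj G a b → r a ≡ r b) →
  (∀ ℓ → HalfEdgeColourable G (λ w → r w ≡ ℓ)) → HalfEdgeColourable G (λ _ → ⊤)
glue-colourings G r r-adj colourings = c , consistent , λ w _ e i e′ i′ ne p q same →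
    proj₂ (proj₂ (colourings (r w))) w refl e i e′ i′ ne p q
      (trans (sym (c-end p)) (trans same (c-end q)))
  where
  c : Ends (nE G) (Fin 3)
  c e i = maybe′ (λ w → proj₁ (colourings (r w)) e i) 0F (end G e i)
  c-end : ∀ {e i w} → end G e i ≡ just w → c e i ≡ proj₁ (colourings (r w)) e i
  c-end {e} {i} = cong (maybe′ (λ w → proj₁ (colourings (r w)) e i) 0F)
  consistent : ∀ e → Attached (end G) e → c e 0F ≡ c e 1F
  consistent e attached with a , p ← attached 0F | b , q ← attached 1F = begin
    c e 0F
      ≡⟨ c-end p ⟩
    proj₁ (colourings (r a)) e 0F
      ≡⟨ cong (λ ℓ → proj₁ (colourings ℓ) e 0F) (r-adj (e , inj₁ (p , q))) ⟩
    proj₁ (colourings (r b)) e 0F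
      ≡⟨ proj₁ (proj₂ (colourings (r b))) e attached ⟩
    proj₁ (colourings (r b)) e 1F
      ≡⟨ c-end q ⟨
    c e 1F ∎
    where open ≡-Reasoning

-- 7-irreducible cubic graphs are bicritical

does≡true⇒ : (a? : Dec A) → does a? ≡ true → A
does≡true⇒ (yes a) _ = a

if-≤ : ∀ b {k} → (b ≡ true → 1 ≤ k) → (if b then 1 else 0) ≤ k
if-≤ true  1≤k = 1≤k refl
if-≤ false _   = z≤n

1≤edgeSum-indicator : (v : Fin n) (ends : Fin 2 → Maybe (Fin n)) → ∀ i → ends i ≡ just v →
  1 ≤ edgeSum (indicator v) ends
1≤edgeSum-indicator v ends i at-v = begin
  1                                       ≡⟨ Indicator.δ-refl ℕₚ.+-*-semiring _≟ᵐ_ (just v) ⟨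
  maybe′ (indicator v) 0 (just v)         ≡⟨ cong (maybe′ (indicator v) 0) at-v ⟨
  maybe′ (indicator v) 0 (ends i)         ≤⟨ ≤-sum (maybe′ (indicator v) 0 ∘ ends) i ⟩
  edgeSum (indicator v) ends              ∎
  where open ℕₚ.≤-Reasoning

edge-at-cubic-vertex : ∀ G → Cubic G → Fin (nV G) → Fin (nE G)
edge-at-cubic-vertex G cubic v with incident _≟ᵐ_ (end G) (just v) | cubic⇒three-incident G cubic v
... | (e , _) ∷ _ | _ = e

module RemovedPair {k m : ℕ} (E : Ends m (Maybe (Fin (suc (suc k)))))
  (cubic : Cubic (mkGraph (suc (suc k)) m E)) (u v : Fin (suc (suc k))) (u≢v : u ≢ v) where

  open TwoDeleted u v u≢v

  G G′ H : Graph
  G  = mkGraph (suc (suc k)) m E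
  G′ = remove2 G u v u≢v
  H  = completion G′

  deg-remaining : ∀ w → deg G′ w ≡ 3
  deg-remaining w = begin
    deg G′ w
      ≡⟨ deg≡length-incident G′ w ⟩
    length (incident _≟ᵐ_ (end G′) (just w))
      ≡⟨ cong length (incident-cong _≟ᵐ_ _≟ᵐ_ (end G′) E λ e i → delete⇔embed (E e i) w) ⟩
    length (incident _≟ᵐ_ E (just (embed w)))
      ≡⟨ cubic⇒three-incident G cubic (embed w) ⟩
    3 ∎
    where open ≡-Reasoning

  H-cubic : Cubic H
  H-cubic = completion-cubic G′ (cubic⇒even G cubic) deg-remaining

  cut : Fin m → Bool
  cut e = not (does (attached? (end G′) e))

  uncut⇒attached : ∀ e → cut e ≡ false → Attached (end G′) e
  uncut⇒attached e uncut = does≡true⇒ (attached? (end G′) e) (not-injective uncut)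

  attached⇒uncut : ∀ e → Attached (end G′) e → cut e ≡ false
  attached⇒uncut e attached = cong not (dec-true (attached? (end G′) e) attached)

  cut⇒detached : ∀ e → cut e ≡ true → ∃ λ i → end G′ e i ≡ nothing
  cut⇒detached e is-cut = ¬attached⇒detached (end G′) λ attached →
    contradiction (trans (sym is-cut) (attached⇒uncut e attached)) λ ()

  detached⇒at-u⊎v : ∀ e i → end G′ e i ≡ nothing → E e i ≡ just u ⊎ E e i ≡ just v
  detached⇒at-u⊎v e i detached with y , p ← proj₁ cubic e i with y ≟ᶠ u | y ≟ᶠ v
  ... | yes refl | _        = inj₁ p
  ... | no _     | yes refl = inj₂ p
  ... | no y≢u   | no y≢v with w , refl ← embed-onto y y≢u y≢v =
    contradiction (trans (sym detached) (trans (cong delete p) (delete-embed w))) λ ()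

  count-cut : count cut ≤ 6
  count-cut = begin
    count cut
      ≡⟨ sumℕ≡sum (λ e → if cut e then 1 else 0) ⟩
    sum (λ e → if cut e then 1 else 0)
      ≤⟨ sum-mono-≤ bound ⟩
    sum (λ e → ends-at u e ℕ.+ ends-at v e)
      ≡⟨ ∑-distrib-+ (ends-at u) (ends-at v) ⟩
    endSum (indicator u) E ℕ.+ endSum (indicator v) E
      ≡⟨ cong₂ ℕ._+_ (deg≡endSum G u) (deg≡endSum G v) ⟨
    deg G u ℕ.+ deg G v
      ≡⟨ cong₂ ℕ._+_ (proj₂ cubic u) (proj₂ cubic v) ⟩
    6 ∎
    where
    open ℕₚ.≤-Reasoning
    open ∑ℕ using (sum; ∑-distrib-+)
    ends-at : Fin (suc (suc k)) → Vector ℕ m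
    ends-at x e = edgeSum (indicator x) (E e)
    bound : ∀ e → (if cut e then 1 else 0) ≤ ends-at u e ℕ.+ ends-at v e
    bound e = if-≤ (cut e) λ is-cut → let i , detached = cut⇒detached e is-cut in
      [ (λ at-u → ℕₚ.≤-trans (1≤edgeSum-indicator u (E e) i at-u) (ℕₚ.m≤m+n _ _))
      , (λ at-v → ℕₚ.≤-trans (1≤edgeSum-indicator v (E e) i at-v) (ℕₚ.m≤n+m _ (ends-at u e)))
      ]′ (detached⇒at-u⊎v e i detached)

  completable : (S : Fin (suc (suc k)) → Bool) → (∀ y → S y ≡ true → ∃ λ a → y ≡ embed a) → Fin k →
    CompletableToSmaller G cut S
  completable S embedded w = H , H-cubic , s≤s (ℕₚ.n≤1+n k) , φ , ψ , φ-injective , ψ-injective ,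
      λ e internal → inj₁ (incidence e internal)
    where
    φ : Fin (suc (suc k)) → Fin k
    φ y = fromMaybe w (delete (just y))
    φ-embed : ∀ a → φ (embed a) ≡ a
    φ-embed a = cong (fromMaybe w) (delete-embed a)
    φ-injective : InjectiveOn S φ
    φ-injective x y Sx Sy eq with a , refl ← embedded x Sx | b , refl ← embedded y Sy =
      cong embed (trans (sym (φ-embed a)) (trans eq (φ-embed b)))
    ψ : Fin m → Fin (nE H)
    ψ e with attached? (end G′) e
    ... | yes attached = place (end G′) attached
    ... | no _         = edge-at-cubic-vertex H H-cubic w
    ψ-place : ∀ e → Internal G cut S e → ∃ λ attached → ψ e ≡ place (end G′) {e} attached
    ψ-place e (uncut , _) with attached? (end G′) e
    ... | yes attached = attached , refl
    ... | no ¬attached = contradiction (uncut⇒attached e uncut) ¬attached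
    ψ-injective : ∀ e e′ → Internal G cut S e → Internal G cut S e′ → ψ e ≡ ψ e′ → e ≡ e′
    ψ-injective e e′ int int′ eq
      with attached , p ← ψ-place e int | attached′ , q ← ψ-place e′ int′ =
      place-injective (end G′) attached attached′ (trans (sym p) (trans eq q))
    incidence : ∀ e → Internal G cut S e → ∀ i → end H (ψ e) i ≡ map φ (E e i)
    incidence e internal i with attached , p ← ψ-place e internal with a , q ← attached i = begin
      end H (ψ e) i                          ≡⟨ cong (λ f → end H f i) p ⟩
      end H (place (end G′) attached) i      ≡⟨ cong-app (joinStubs-place (end G′) attached) i ⟩
      end G′ e i                             ≡⟨ q ⟩
      just a                                 ≡⟨ cong just (φ-embed a) ⟨
      just (φ (embed a))                     ≡⟨ cong (map φ) (delete⁻ (E e i) q) ⟨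
      map φ (E e i)                          ∎
      where open ≡-Reasoning

  label : Fin k → Fin k
  label = proj₁ (components G′)

  label-classes : ∀ a b → label a ≡ label b ⇔ Star (Adj G′) a b
  label-classes = proj₂ (components G′)

  label-adj : ∀ {a b} → Adj G′ a b → label a ≡ label b
  label-adj {a} {b} adj = Equivalence.from (label-classes a b) (Star.return adj)

  labelled? : ∀ ℓ y → Dec (map label (delete (just y)) ≡ just ℓ)
  labelled? ℓ y = map label (delete (just y)) ≟ᵐ just ℓ

  labelled : Fin k → Fin (suc (suc k)) → Bool
  labelled ℓ y = does (labelled? ℓ y)

  labelled⁻ : ∀ ℓ y → labelled ℓ y ≡ true → ∃ λ w → y ≡ embed w × label w ≡ ℓ
  labelled⁻ ℓ y member with delete (just y) in eq | does≡true⇒ (labelled? ℓ y) member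
  ... | just w | same = w , just-injective (delete⁻ (just y) eq) , just-injective same

  labelled⁺ : ∀ ℓ w → label w ≡ ℓ → labelled ℓ (embed w) ≡ true
  labelled⁺ ℓ w w∈ℓ = dec-true (labelled? ℓ (embed w))
    (trans (cong (map label) (delete-embed w)) (cong just w∈ℓ))

  adj⇒adjOff : ∀ S {a b} → Adj G′ a b → AdjOff G cut S (embed a) (embed b)
  adj⇒adjOff S (e , inj₁ (p , q)) = e , attached⇒uncut e (λ { 0F → _ , p ; 1F → _ , q }) ,
    inj₁ (delete⁻ (E e 0F) p , delete⁻ (E e 1F) q)
  adj⇒adjOff S (e , inj₂ (p , q)) = e , attached⇒uncut e (λ { 0F → _ , p ; 1F → _ , q }) ,
    inj₂ (delete⁻ (E e 0F) p , delete⁻ (E e 1F) q)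

  labelled-component : ∀ w → Component G cut (labelled (label w))
  labelled-component w = (embed w , labelled⁺ (label w) w refl) , closed , connected
    where
    S : Fin (suc (suc k)) → Bool
    S = labelled (label w)
    closed : ∀ e x y → cut e ≡ false → E e 0F ≡ just x → E e 1F ≡ just y → S x ≡ S y
    closed e x y uncut p q
      with a , p′ ← uncut⇒attached e uncut 0F | b , q′ ← uncut⇒attached e uncut 1F =
      cong (λ l → does (l ≟ᵐ just (label w))) (begin
        map label (delete (just x))   ≡⟨ cong (map label ∘ delete) p ⟨
        map label (end G′ e 0F)       ≡⟨ cong (map label) p′ ⟩
        just (label a)                ≡⟨ cong just (label-adj (e , inj₁ (p′ , q′))) ⟩
        just (label b)                ≡⟨ cong (map label) q′ ⟨
        map label (end G′ e 1F)       ≡⟨ cong (map label ∘ delete) q ⟩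
        map label (delete (just y))   ∎)
      where open ≡-Reasoning
    connected : ∀ x y → S x ≡ true → S y ≡ true → Star (AdjOff G cut S) x y
    connected x y Sx Sy
      with a , refl , p ← labelled⁻ (label w) x Sx | b , refl , q ← labelled⁻ (label w) y Sy =
      Star.gmap embed (adj⇒adjOff S) (Equivalence.to (label-classes a b) (trans p (sym q)))

  restrict-colouring : ∀ ℓ → ComponentColourable G cut (labelled ℓ) →
    HalfEdgeColourable G′ (λ w → label w ≡ ℓ)
  restrict-colouring ℓ (c , consistent , proper) =
    c , (λ e attached → consistent e (attached⇒uncut e attached)) , λ w w∈ℓ e i e′ i′ ne p q →
      proper (embed w) (labelled⁺ ℓ w w∈ℓ) e i e′ i′ ne (delete⁻ (E e i) p) (delete⁻ (E e′ i′) q)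

  label-¬¬colourable : KIrreducible 7 G → ∀ ℓ → ¬ ¬ HalfEdgeColourable G′ (λ w → label w ≡ ℓ)
  label-¬¬colourable irreducible ℓ uncolourable with any? (λ w → label w ≟ᶠ ℓ)
  ... | no empty       = uncolourable
    ((λ _ _ → 0F) , (λ _ _ → refl) , λ w w∈ℓ → contradiction (w , w∈ℓ) empty)
  ... | yes (w , refl) = irreducible cut (s≤s count-cut) (labelled ℓ) (labelled-component w)
    (uncolourable ∘ restrict-colouring ℓ)
    (completable (labelled ℓ) (λ y → map₂ proj₁ ∘ labelled⁻ ℓ y) w)

-- Irreducibility only refutes the uncolourability of each component.  Double negation commutes
-- with the finite product over the components, and the colourability of G − {u, v} is decidable.
7-irreducible⇒bicritical : ∀ G → Cubic G → KIrreducible 7 G → Bicritical G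
7-irreducible⇒bicritical (mkGraph (suc zero) m E) _ _ 0F 0F u≢v = contradiction refl u≢v
7-irreducible⇒bicritical (mkGraph (suc (suc k)) m E) cubic irreducible u v u≢v =
  decidable-stable (colourable? G′) (¬¬-map
    (halfEdgeColourable⇒colourable G′ ∘ glue-colourings G′ label label-adj)
    (sequence (RawMonad.rawApplicative ¬¬-Monad) (label-¬¬colourable irreducible)))
  where open RemovedPair E cubic u v u≢v

theorem5 : (G : Graph) → Snark G →
    (Bicritical G ⇔ FourVertexCritical G) ×
    (Bicritical G ⇔ KIrreducible 7 G) ×
    (Bicritical G ⇔ Irreducible G)
theorem5 G (cubic , _) =
  bicritical⇔fourVertexCritical G cubic ,
  mk⇔ (λ bicritical → irreducible bicritical 7) (7-irreducible⇒bicritical G cubic) ,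
  mk⇔ (λ bicritical k _ → irreducible bicritical k)
      (λ irreducible → 7-irreducible⇒bicritical G cubic (irreducible 7 (s≤s z≤n)))
  where
  irreducible : Bicritical G → ∀ k → KIrreducible k G
  irreducible = bicritical⇒kIrreducible G cubic
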